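{- Let $\phi\to\psi$ be a skeletal Sahlqvist formula of $\mathcal{L}(@,\downarrow)$ and let $\mathsf{Pure}(\phi\to\psi)$ be the set of pure quasi-inequalities output by the algorithm $\mathsf{ALBA}^{\downarrow}_{\mathsf{Restricted}}$ on input $\phi\to\psi$. Then for each quasi-inequality $\mathsf{Quasi}$ in $\mathsf{Pure}(\phi\to\psi)$ we have $\vdash_{\phi\to\psi}\mathsf{Tr}(\mathsf{Quasi})$, and therefore $\vdash_{\phi\to\psi}\mathsf{Tr}(\mathsf{Pure}(\phi\to\psi))$.
   Context: **Language.** Let $\mathsf{Prop}$ (propositional variables), $\mathsf{Svar}$ (state variables), $\mathsf{Nom}$ (nominals) be pairwise disjoint countably infinite sets. Formulas of $\mathcal{L}(@,\downarrow)$: $\varphi::=p\mid x\mid\mathbf{i}\mid\bot\mid\top\mid\neg\varphi\mid\varphi\lor\varphi\mid\varphi\land\varphi\mid\varphi\to\varphi\mid\Diamond\varphi\mid\Box\varphi\mid @_x\varphi\mid @_{\mathbf{i}}\varphi\mid\downarrow x.\varphi$, with $p\in\mathsf{Prop}$, $x\in\mathsf{Svar}$, $\mathbf{i}\in\mathsf{Nom}$. The binder $\downarrow x$ binds $x$. Terms are nominals and state variables. A formula is pure if it contains no propositional variables. A substitution $\sigma$ uniformly replaces propositional variables by formulas and terms by terms; it is safe for $\phi$ if it does not make free occurrences of a state variable $x$ be substituted into the scope of $\downarrow x$. Inequalities are expressions $\alpha\leq\beta$ between formulas; quasi-inequalities are expressions $\alpha_1\leq\beta_1\ \&\ \dots\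 \&\ \alpha_n\leq\beta_n\Rightarrow\alpha\leq\beta$; they are pure if all formulas in them are. **Hilbert system $\mathbf{K}_{\mathcal{H}(@,\downarrow)}$.** Axioms: all classical tautologies; (Dual) $\Diamond p\leftrightarrow\neg\Box\neg p$; (K) $\Box(p\to q)\to(\Box p\to\Box q)$; (K$_@$) $@_{\mathbf{i}}(p\to q)\to(@_{\mathbf{i}}p\to @_{\mathbf{i}}q)$; (Selfdual) $\neg@_{\mathbf{i}}p\leftrightarrow @_{\mathbf{i}}\neg p$; (Ref) $@_{\mathbf{i}}\mathbf{i}$; (Intro) $\mathbf{i}\land p\to @_{\mathbf{i}}p$; (Back) $\Diamond @_{\mathbf{i}}p\to @_{\mathbf{i}}p$; (Agree) $@_{\mathbf{i}}@_{\mathbf{j}}p\to @_{\mathbf{j}}p$; (DA) $@_{\mathbf{i}}(\downarrow x.\phi\leftrightarrow\phi[\mathbf{i}/x])$, where $\phi[\mathbf{i}/x]$ replaces the free occurrences of $x$ in $\phi$ by $\mathbf{i}$; (Name$_\downarrow$) $\downarrow x.@_x\phi\to\phi$ if $x$ does not occur in $\phi$; (BG$_\downarrow$) $@_{\mathbf{i}}\Box\downarrow x.@_{\mathbf{i}}\Diamond x$. Rules: modus ponens; (SB) from $\phi$ infer $\phi^\sigma$ for $\sigma$ safe for $\phi$; from $\phi$ infer $\Box\phi$; from $\phi$ infer $@_{\mathbf{i}}\phi$; from $\phi$ infer $\downarrow x.\phi$. $\vdash_{\phi\to\psi}\theta$ means that $\theta$ is a theorem of $\mathbf{K}_{\mathcal{H}(@,\downarrow)}+(\phi\to\psi)$,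 the system obtained by adding $\phi\to\psi$ as an axiom and closing under these rules. **Skeletal Sahlqvist formulas.** An order-type of propositional variables $(p_1,\dots,p_n)$ is $\epsilon\in\{1,\partial\}^n$. The positive (negative) signed generation tree $+\phi$ ($-\phi$) is the generation (syntax) tree of $\phi$ with root signed $+$ ($-$), signs propagated downwards: $\lor,\land,\Box,\Diamond,\downarrow x$ give their children the same sign; $\neg$ the opposite sign; $\to$ the opposite sign to its first child and the same sign to its second; $@$ the same sign to its second (formula) child, the nominal or state variable index not being labelled. $p$ is positive (negative) in $\phi$ if all its occurrences in $+\phi$ are signed $+$ ($-$). A leaf $+p_i$ with $\epsilon_i=1$ or $-p_i$ with $\epsilon_i=\partial$ is $\epsilon$-critical; an $\epsilon$-critical branch is a branch from such a leaf to the root. Skeletal nodes are: $+\lor,+\land,+\Diamond,+\neg,+\downarrow x,+@$ and $-\land,-\lor,-\Box,-\neg,-\downarrow x,-@,-\to$. A branch is skeletal if, apart from variable nodes, it consists of skeletal nodes only. A signed tree is $\epsilon$-skeletal Sahlqvist if every $\epsilon$-critical branch is skeletal. $\phi\to\psi$ is skeletal Sahlqvist if for some $\epsilon$ both $+\phi$ and $-\psi$ are $\epsilon$-skeletal Sahlqvist. **Algorithm $\mathsf{ALBA}^{\downarrow}_{\mathsf{Restricted}}$.** Input $\phi\to\psi$, turned into the inequality $\phi\leq\psi$. *Stage 1 (preprocessing and first approximation).* In the signed trees of $+\phi$ and $-\psi$ apply exhaustively the following. (a) Distribution rules: push $+\Diamond,+\downarrow x,+@_{\mathbf{i}},+@_x,-\neg,+\land,-\to$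 down over nodes $+\lor$, i.e. rewrite $\triangle(\alpha\lor\beta)$ to $\triangle\alpha\lor\triangle\beta$ for $\triangle\in\{\Diamond,\downarrow x,@_{\mathbf{i}},@_x\}$, $\neg(\alpha\lor\beta)$ to $\neg\alpha\land\neg\beta$, $\alpha\land(\beta\lor\gamma)$ to $(\alpha\land\beta)\lor(\alpha\land\gamma)$, $(\alpha\lor\beta)\land\gamma$ to $(\alpha\land\gamma)\lor(\beta\land\gamma)$, $(\alpha\lor\beta)\to\gamma$ to $(\alpha\to\gamma)\land(\beta\to\gamma)$; and push $-\Box,-\downarrow x,-@_{\mathbf{i}},-@_x,+\neg,-\lor,-\to$ down over nodes $-\land$, i.e. rewrite $\triangle(\alpha\land\beta)$ to $\triangle\alpha\land\triangle\beta$ for $\triangle\in\{\Box,\downarrow x,@_{\mathbf{i}},@_x\}$, $\neg(\alpha\land\beta)$ to $\neg\alpha\lor\neg\beta$, $\alpha\lor(\beta\land\gamma)$ to $(\alpha\lor\beta)\land(\alpha\lor\gamma)$, $(\alpha\land\beta)\lor\gamma$ to $(\alpha\lor\gamma)\land(\beta\lor\gamma)$, $\alpha\to(\beta\land\gamma)$ to $(\alpha\to\beta)\land(\alpha\to\gamma)$. (b) Splitting: replace $\alpha\lor\beta\leq\gamma$ by $\alpha\leq\gamma$ and $\beta\leq\gamma$; replace $\alpha\leq\beta\land\gamma$ by $\alpha\leq\beta$ and $\alpha\leq\gamma$. (c) Variable elimination: for $\beta(p)$ positive and $\alpha(p)$ negative in $p$, replace $\alpha(p)\leq\beta(p)$ by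 $\alpha(\bot)\leq\beta(\bot)$, and $\beta(p)\leq\alpha(p)$ by $\beta(\top)\leq\alpha(\top)$. The resulting finite set is $\mathsf{Preprocess}(\phi\leq\psi)=\{\phi_i\leq\psi_i\}_{i\in I}$. First approximation: replace each $\phi_i\leq\psi_i$ by the system $\{\mathbf{i}_0\leq\phi_i,\ \psi_i\leq\neg\mathbf{i}_1\}$ with $\mathbf{i}_0,\mathbf{i}_1$ fresh nominals. *Stage 2 (reduction).* For each system separately. Substage 1: apply the following rules to decompose skeletal branches, replacing an inequality by those after the arrow; here $s,t$ denote arbitrary terms, and $\mathbf{j},\mathbf{k}$ in the $\Diamond$, $\Box$, $\to$ rules are nominals not occurring in the system before the rule is applied. Splitting ($s$ a nominal $\mathbf{i}$): $s\leq\beta\land\gamma\rightsquigarrow s\leq\beta,\ s\leq\gamma$; $\alpha\lor\beta\leq\neg s\rightsquigarrow\alpha\leq\neg s,\ \beta\leq\neg s$. Approximation: $s\leq\Diamond\alpha\rightsquigarrow\mathbf{j}\leq\alpha,\ s\leq\Diamond\mathbf{j}$; $\Box\alpha\leq\neg s\rightsquigarrow\alpha\leq\neg\mathbf{j},\ \Box\neg\mathbf{j}\leq\neg s$; $s\leq @_t\alpha\rightsquigarrow t\leq\alpha$; $@_t\alpha\leq\neg s\rightsquigarrow\alpha\leq\neg t$; $s\leq\downarrow x.\alpha\rightsquigarrow s\leq\alpha[s/x]$; $\downarrow x.\alpha\leq\neg s\rightsquigarrow\alpha[s/x]\leq\neg s$; $\alpha\to\beta\leq\neg s\rightsquigarrow\mathbf{j}\leq\alpha,\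 \beta\leq\neg\mathbf{k},\ \mathbf{j}\to\neg\mathbf{k}\leq\neg s$. Residuation: $s\leq\neg\alpha\rightsquigarrow\alpha\leq\neg s$; $\neg\alpha\leq\neg s\rightsquigarrow s\leq\alpha$. Here $\alpha[s/x]$ replaces all free occurrences of $x$ in $\alpha$ by $s$. Substage 2 (Ackermann rules, acting on the whole system; all $s_i,t_j,u_l$ are terms). Right-handed: the system $\{s_1\leq p,\dots,s_n\leq p,\ t_1\leq\gamma_1,\dots,t_m\leq\gamma_m,\ \beta_1\leq\neg u_1,\dots,\beta_k\leq\neg u_k\}$, with each $\beta_l$ positive and each $\gamma_j$ negative in $p$, is replaced by $\{t_j\leq\gamma_j[\theta/p]\}_{j\le m}\cup\{\beta_l[\theta/p]\leq\neg u_l\}_{l\le k}$ with $\theta=s_1\lor\dots\lor s_n$. Left-handed: the system $\{p\leq\neg s_1,\dots,p\leq\neg s_n\}\cup\{t_j\leq\gamma_j\}_{j\le m}\cup\{\beta_l\leq\neg u_l\}_{l\le k}$, with each $\beta_l$ negative and each $\gamma_j$ positive in $p$, is replaced by $\{t_j\leq\gamma_j[\theta/p]\}_{j\le m}\cup\{\beta_l[\theta/p]\leq\neg u_l\}_{l\le k}$ with $\theta=\neg s_1\land\dots\land\neg s_n$. All substitutions are safe (bound state variables being renamed if necessary). *Stage 3 (output).* If in some system some propositional variable cannot be eliminated, output failure. Otherwise each system $\{\mathbf{i}_0\leq\phi_i,\psi_i\leq\neg\mathbf{i}_1\}$ has been reduced to a set $\mathsf{Reduce}(\phi_i\leq\psi_i)$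 of pure inequalities. Form the quasi-inequalities $\&\mathsf{Reduce}(\phi_i\leq\psi_i)\Rightarrow\mathbf{i}_0\leq\neg\mathbf{i}_1$, $i\in I$, and uniformly substitute all free occurrences of state variables by fresh nominals; the resulting set is $\mathsf{Pure}(\phi\to\psi)$. **Translation.** For a term $s$: $\mathsf{Tr}(s\leq\gamma):=@_s\gamma$ and $\mathsf{Tr}(\gamma\leq\neg s):=\neg@_s\gamma$ (if an inequality has more than one of these forms, any of them may be taken). For a quasi-inequality whose premises have these forms, $\mathsf{Tr}(\mathsf{Ineq}_1\ \&\dots\&\ \mathsf{Ineq}_n\Rightarrow\mathbf{i}\leq\neg\mathbf{j}):=\mathsf{Tr}(\mathsf{Ineq}_1)\land\dots\land\mathsf{Tr}(\mathsf{Ineq}_n)\to\neg@_{\mathbf{i}}\mathbf{j}$. For a finite set of such quasi-inequalities, $\mathsf{Tr}$ is the conjunction of the translations of its members. -}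

module Defs where

open import Data.Bool.Base using (Bool; true; false; not; _∧_; _∨_)
open import Data.Empty using (⊥)
open import Data.List.Base using (List; []; _∷_; _++_; map)
open import Data.List.Membership.Propositional using (_∈_; _∉_)
open import Data.List.Relation.Binary.BagAndSetEquality using (_∼[_]_; set)
open import Data.List.Relation.Binary.Pointwise using (Pointwise)
open import Data.List.Relation.Unary.All using (All)
open import Data.Nat.Base using (ℕ)
open import Data.Nat.Properties using (_≟_)
open import Data.Product.Base using (∃; ∃-syntax; _×_; _,_; proj₁; proj₂)
open import Data.Sign.Base using (Sign; +; -; opposite)
open import Data.Sum.Base using (_⊎_)
open import Data.Unit.Base using (⊤)
open import Function.Base using (_∘_)
open import Function.Definitions using (Injective)
open import Relation.Binary.Construct.Closure.ReflexiveTransitive using (Star)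
open import Relation.Binary.PropositionalEquality using (_≡_; _≢_)
open import Relation.Binary.Rewriting using (IsNormalForm)
open import Relation.Nullary.Decidable using (yes; no)
open import Relation.Nullary.Negation using (¬_)

PropVar Svar Nom : Set
PropVar = ℕ
Svar    = ℕ
Nom     = ℕ

data Term : Set where
  nom  : Nom → Term
  svar : Svar → Term

infixr 5 _⇒_ _⇔_
infixr 6 _∨ᶠ_
infixr 7 _∧ᶠ_
infixr 8 ¬ᶠ_ ◇_ □_ at[_]_ ↓[_]_

data Form : Set where
  var          : PropVar → Form
  tm           : Term → Form
  ⊥ᶠ ⊤ᶠ        : Form
  ¬ᶠ_          : Form → Form
  _∨ᶠ_ _∧ᶠ_ _⇒_ : Form → Form → Form
  ◇_ □_        : Form → Form
  at[_]_       : Term → Form → Form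
  ↓[_]_        : Svar → Form → Form

_⇔_ : Form → Form → Form
α ⇔ β = (α ⇒ β) ∧ᶠ (β ⇒ α)

⋁ ⋀ : List Form → Form
⋁ []             = ⊥ᶠ
⋁ (α ∷ [])       = α
⋁ (α ∷ αs@(_ ∷ _)) = α ∨ᶠ ⋁ αs
⋀ []             = ⊤ᶠ
⋀ (α ∷ [])       = α
⋀ (α ∷ αs@(_ ∷ _)) = α ∧ᶠ ⋀ αs

data Symbol : Set where
  prop : PropVar → Symbol
  term : Term → Symbol

infix 4 _freeIn_ _occursIn_

-- Only state variables are ever bound: every occurrence of a propositional
-- variable or of a nominal is free.
_freeIn_ : Symbol → Form → Set
a freeIn var p      = a ≡ prop p
a freeIn tm t       = a ≡ term t
a freeIn ⊥ᶠ         = ⊥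
a freeIn ⊤ᶠ         = ⊥
a freeIn (¬ᶠ α)     = a freeIn α
a freeIn (α ∨ᶠ β)   = a freeIn α ⊎ a freeIn β
a freeIn (α ∧ᶠ β)   = a freeIn α ⊎ a freeIn β
a freeIn (α ⇒ β)    = a freeIn α ⊎ a freeIn β
a freeIn (◇ α)      = a freeIn α
a freeIn (□ α)      = a freeIn α
a freeIn (at[ t ] α) = a ≡ term t ⊎ a freeIn α
a freeIn (↓[ x ] α) = a ≢ term (svar x) × a freeIn α

-- Counts bound occurrences, and the x of the binder ↓x as well.
_occursIn_ : Symbol → Form → Set
a occursIn var p      = a ≡ prop p
a occursIn tm t       = a ≡ term t
a occursIn ⊥ᶠ         = ⊥
a occursIn ⊤ᶠ         = ⊥
a occursIn (¬ᶠ α)     = a occursIn α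
a occursIn (α ∨ᶠ β)   = a occursIn α ⊎ a occursIn β
a occursIn (α ∧ᶠ β)   = a occursIn α ⊎ a occursIn β
a occursIn (α ⇒ β)    = a occursIn α ⊎ a occursIn β
a occursIn (◇ α)      = a occursIn α
a occursIn (□ α)      = a occursIn α
a occursIn (at[ t ] α) = a ≡ term t ⊎ a occursIn α
a occursIn (↓[ x ] α) = a ≡ term (svar x) ⊎ a occursIn α

Pure : Form → Set
Pure α = ∀ p → ¬ (prop p occursIn α)

record Subst : Set where
  constructor subst
  field
    onProp : PropVar → Form
    onTerm : Term → Term

open Subst public

image : Subst → Symbol → Form
image σ (prop p) = onProp σ p
image σ (term t) = tm (onTerm σ t)

idˢ : Subst
idˢ = subst var (λ t → t)

_[_≔_]ᵖ : Subst → PropVar → Form → Subst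
onProp (σ [ p ≔ θ ]ᵖ) q with q ≟ p
... | yes _ = θ
... | no  _ = onProp σ q
onTerm (σ [ p ≔ θ ]ᵖ) = onTerm σ

_[_≔_]ˢ : Subst → Svar → Term → Subst
onProp (σ [ x ≔ s ]ˢ) = onProp σ
onTerm (σ [ x ≔ s ]ˢ) (nom i) = onTerm σ (nom i)
onTerm (σ [ x ≔ s ]ˢ) (svar y) with y ≟ x
... | yes _ = s
... | no  _ = onTerm σ (svar y)

[_/ᵖ_] : Form → PropVar → Subst
[ θ /ᵖ p ] = idˢ [ p ≔ θ ]ᵖ

[_/ˢ_] : Term → Svar → Subst
[ s /ˢ x ] = idˢ [ x ≔ s ]ˢ

infixl 9 _^_

-- Literal simultaneous replacement of the free occurrences, with no renaming
-- of bound variables; it may capture unless Safe (below) holds.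
_^_ : Form → Subst → Form
var p      ^ σ = onProp σ p
tm t       ^ σ = tm (onTerm σ t)
⊥ᶠ         ^ σ = ⊥ᶠ
⊤ᶠ         ^ σ = ⊤ᶠ
(¬ᶠ α)     ^ σ = ¬ᶠ (α ^ σ)
(α ∨ᶠ β)   ^ σ = (α ^ σ) ∨ᶠ (β ^ σ)
(α ∧ᶠ β)   ^ σ = (α ^ σ) ∧ᶠ (β ^ σ)
(α ⇒ β)    ^ σ = (α ^ σ) ⇒ (β ^ σ)
(◇ α)      ^ σ = ◇ (α ^ σ)
(□ α)      ^ σ = □ (α ^ σ)
(at[ t ] α) ^ σ = at[ onTerm σ t ] (α ^ σ)
(↓[ x ] α) ^ σ = ↓[ x ] (α ^ (σ [ x ≔ svar x ]ˢ))

Safe : Subst → Form → Set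
Safe σ (var p)      = ⊤
Safe σ (tm t)       = ⊤
Safe σ ⊥ᶠ           = ⊤
Safe σ ⊤ᶠ           = ⊤
Safe σ (¬ᶠ α)       = Safe σ α
Safe σ (α ∨ᶠ β)     = Safe σ α × Safe σ β
Safe σ (α ∧ᶠ β)     = Safe σ α × Safe σ β
Safe σ (α ⇒ β)      = Safe σ α × Safe σ β
Safe σ (◇ α)        = Safe σ α
Safe σ (□ α)        = Safe σ α
Safe σ (at[ t ] α)  = Safe σ α
Safe σ (↓[ x ] α)   =
  (∀ a → a freeIn (↓[ x ] α) → ¬ (term (svar x) freeIn image σ a)) ×
  Safe (σ [ x ≔ svar x ]ˢ) α

infix 4 _≈α_

-- Equality up to renaming of bound state variables.
data _≈α_ : Form → Form → Set where
  ≈refl   : ∀ {α} → α ≈α α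
  ≈sym    : ∀ {α β} → α ≈α β → β ≈α α
  ≈trans  : ∀ {α β γ} → α ≈α β → β ≈α γ → α ≈α γ
  rename  : ∀ {x y α} → ¬ (term (svar y) occursIn α) →
            ↓[ x ] α ≈α ↓[ y ] (α ^ [ svar y /ˢ x ])
  ¬-cong  : ∀ {α α′} → α ≈α α′ → ¬ᶠ α ≈α ¬ᶠ α′
  ∨-cong  : ∀ {α α′ β β′} → α ≈α α′ → β ≈α β′ → α ∨ᶠ β ≈α α′ ∨ᶠ β′
  ∧-cong  : ∀ {α α′ β β′} → α ≈α α′ → β ≈α β′ → α ∧ᶠ β ≈α α′ ∧ᶠ β′
  ⇒-cong  : ∀ {α α′ β β′} → α ≈α α′ → β ≈α β′ → (α ⇒ β) ≈α (α′ ⇒ β′)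
  ◇-cong  : ∀ {α α′} → α ≈α α′ → ◇ α ≈α ◇ α′
  □-cong  : ∀ {α α′} → α ≈α α′ → □ α ≈α □ α′
  at-cong : ∀ {t α α′} → α ≈α α′ → at[ t ] α ≈α at[ t ] α′
  ↓-cong  : ∀ {x α α′} → α ≈α α′ → ↓[ x ] α ≈α ↓[ x ] α′

infix 4 _[_]↝_

-- α [ σ ]↝ β: β results from α by applying σ safely, after a renaming of
-- bound state variables of α that makes this possible.
_[_]↝_ : Form → Subst → Form → Set
α [ σ ]↝ β = ∃[ α′ ] (α ≈α α′ × Safe σ α′ × β ≡ α′ ^ σ)

-- Everything not built by a Boolean connective is treated as an atom.
eval : (Form → Bool) → Form → Bool
eval v ⊥ᶠ       = false
eval v ⊤ᶠ       = true
eval v (¬ᶠ α)   = not (eval v α)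
eval v (α ∨ᶠ β) = eval v α ∨ eval v β
eval v (α ∧ᶠ β) = eval v α ∧ eval v β
eval v (α ⇒ β)  = not (eval v α) ∨ eval v β
eval v α        = v α

Tautology : Form → Set
Tautology α = ∀ v → eval v α ≡ true

data Axiom : Form → Set where
  taut     : ∀ {α} → Tautology α → Axiom α
  dual     : ∀ p → Axiom (◇ var p ⇔ ¬ᶠ □ ¬ᶠ var p)
  K        : ∀ p q → Axiom (□ (var p ⇒ var q) ⇒ □ var p ⇒ □ var q)
  K-at     : ∀ i p q → Axiom (at[ nom i ] (var p ⇒ var q) ⇒
                              at[ nom i ] var p ⇒ at[ nom i ] var q)
  selfdual : ∀ i p → Axiom (¬ᶠ at[ nom i ] var p ⇔ at[ nom i ] ¬ᶠ var p)
  ref      : ∀ i → Axiom (at[ nom i ] tm (nom i))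
  intro    : ∀ i p → Axiom (tm (nom i) ∧ᶠ var p ⇒ at[ nom i ] var p)
  back     : ∀ i p → Axiom (◇ at[ nom i ] var p ⇒ at[ nom i ] var p)
  agree    : ∀ i j p → Axiom (at[ nom i ] at[ nom j ] var p ⇒ at[ nom j ] var p)
  DA       : ∀ i x α → Axiom (at[ nom i ] (↓[ x ] α ⇔ α ^ [ nom i /ˢ x ]))
  name↓    : ∀ {x α} → ¬ (term (svar x) occursIn α) →
             Axiom (↓[ x ] at[ svar x ] α ⇒ α)
  BG↓      : ∀ i x → Axiom (at[ nom i ] □ ↓[ x ] at[ nom i ] ◇ tm (svar x))

infix 3 ⊢[_]_

data ⊢[_]_ (χ : Form) : Form → Set where
  axiom : ∀ {α} → Axiom α → ⊢[ χ ] α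
  extra : ⊢[ χ ] χ
  MP    : ∀ {α β} → ⊢[ χ ] (α ⇒ β) → ⊢[ χ ] α → ⊢[ χ ] β
  SB    : ∀ {α} σ → Safe σ α → ⊢[ χ ] α → ⊢[ χ ] (α ^ σ)
  nec-□ : ∀ {α} → ⊢[ χ ] α → ⊢[ χ ] □ α
  nec-at : ∀ {α} i → ⊢[ χ ] α → ⊢[ χ ] at[ nom i ] α
  nec-↓ : ∀ {α} x → ⊢[ χ ] α → ⊢[ χ ] ↓[ x ] α

data Connective : Set where
  neg or and imp dia box sat bind : Connective

SignedNode : Set
SignedNode = Sign × Connective

-- Branch s α t p ns: in the generation tree of α with root sign s there is a
-- branch with inner nodes ns (from the root down) to a leaf p signed t.
data Branch : Sign → Form → Sign → PropVar → List SignedNode → Set where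
  leaf : ∀ {s p} → Branch s (var p) s p []
  ¬-br : ∀ {s α t p ns} → Branch (opposite s) α t p ns →
         Branch s (¬ᶠ α) t p ((s , neg) ∷ ns)
  ∨-l  : ∀ {s α β t p ns} → Branch s α t p ns → Branch s (α ∨ᶠ β) t p ((s , or) ∷ ns)
  ∨-r  : ∀ {s α β t p ns} → Branch s β t p ns → Branch s (α ∨ᶠ β) t p ((s , or) ∷ ns)
  ∧-l  : ∀ {s α β t p ns} → Branch s α t p ns → Branch s (α ∧ᶠ β) t p ((s , and) ∷ ns)
  ∧-r  : ∀ {s α β t p ns} → Branch s β t p ns → Branch s (α ∧ᶠ β) t p ((s , and) ∷ ns)
  ⇒-l  : ∀ {s α β t p ns} → Branch (opposite s) α t p ns →
         Branch s (α ⇒ β) t p ((s , imp) ∷ ns)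
  ⇒-r  : ∀ {s α β t p ns} → Branch s β t p ns → Branch s (α ⇒ β) t p ((s , imp) ∷ ns)
  ◇-br : ∀ {s α t p ns} → Branch s α t p ns → Branch s (◇ α) t p ((s , dia) ∷ ns)
  □-br : ∀ {s α t p ns} → Branch s α t p ns → Branch s (□ α) t p ((s , box) ∷ ns)
  at-br : ∀ {s u α t p ns} → Branch s α t p ns →
          Branch s (at[ u ] α) t p ((s , sat) ∷ ns)
  ↓-br : ∀ {s x α t p ns} → Branch s α t p ns →
         Branch s (↓[ x ] α) t p ((s , bind) ∷ ns)

Positive Negative : PropVar → Form → Set
Positive p α = ∀ {t ns} → Branch + α t p ns → t ≡ +
Negative p α = ∀ {t ns} → Branch + α t p ns → t ≡ -

data SkeletalNode : SignedNode → Set where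
  +or   : SkeletalNode (+ , or)
  +and  : SkeletalNode (+ , and)
  +dia  : SkeletalNode (+ , dia)
  +neg  : SkeletalNode (+ , neg)
  +bind : SkeletalNode (+ , bind)
  +sat  : SkeletalNode (+ , sat)
  -and  : SkeletalNode (- , and)
  -or   : SkeletalNode (- , or)
  -box  : SkeletalNode (- , box)
  -neg  : SkeletalNode (- , neg)
  -bind : SkeletalNode (- , bind)
  -sat  : SkeletalNode (- , sat)
  -imp  : SkeletalNode (- , imp)

data Order : Set where
  𝟙 ∂ : Order

-- Only the values at the finitely many variables of a formula matter.
OrderType : Set
OrderType = PropVar → Order

data Critical (ε : OrderType) : Sign → PropVar → Set where
  +critical : ∀ {p} → ε p ≡ 𝟙 → Critical ε + p
  -critical : ∀ {p} → ε p ≡ ∂ → Critical ε - p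

Skeletal : OrderType → Sign → Form → Set
Skeletal ε s α = ∀ {t p ns} → Branch s α t p ns → Critical ε t p → All SkeletalNode ns

SkeletalSahlqvist : Form → Form → Set
SkeletalSahlqvist φ ψ = ∃[ ε ] (Skeletal ε + φ × Skeletal ε - ψ)

infix 4 _≼_
infix 3 &_⟹_

record Ineq : Set where
  constructor _≼_
  field
    lhs rhs : Form

record Quasi : Set where
  constructor &_⟹_
  field
    premises   : List Ineq
    conclusion : Ineq

PureIneq : Ineq → Set
PureIneq (α ≼ β) = Pure α × Pure β

_occursInIneq_ : Symbol → Ineq → Set
a occursInIneq (α ≼ β) = a occursIn α ⊎ a occursIn β

-- Lists of inequalities stand for finite sets: rules are applied modulo
-- _∼[ set ]_.
System : Set
System = List Ineq

FreshNom : Nom → System → Set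
FreshNom j S = All (λ e → ¬ (term (nom j) occursInIneq e)) S

data Replace (R : Ineq → System → Set) : System → System → Set where
  replace : ∀ {S e Γ new} → S ∼[ set ] e ∷ Γ → e ∉ Γ → R e new →
            Replace R S (new ++ Γ)

-- Distribute s α β: β results from one distribution step inside the
-- generation tree of α with root sign s.
data Distribute : Sign → Form → Form → Set where
  +◇∨  : ∀ {α β} → Distribute + (◇ (α ∨ᶠ β)) (◇ α ∨ᶠ ◇ β)
  +↓∨  : ∀ {x α β} → Distribute + (↓[ x ] (α ∨ᶠ β)) (↓[ x ] α ∨ᶠ ↓[ x ] β)
  +at∨ : ∀ {t α β} → Distribute + (at[ t ] (α ∨ᶠ β)) (at[ t ] α ∨ᶠ at[ t ] β)
  -¬∨  : ∀ {α β} → Distribute - (¬ᶠ (α ∨ᶠ β)) (¬ᶠ α ∧ᶠ ¬ᶠ β)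
  +∧∨ʳ : ∀ {α β γ} → Distribute + (α ∧ᶠ (β ∨ᶠ γ)) ((α ∧ᶠ β) ∨ᶠ (α ∧ᶠ γ))
  +∧∨ˡ : ∀ {α β γ} → Distribute + ((α ∨ᶠ β) ∧ᶠ γ) ((α ∧ᶠ γ) ∨ᶠ (β ∧ᶠ γ))
  -⇒∨  : ∀ {α β γ} → Distribute - ((α ∨ᶠ β) ⇒ γ) ((α ⇒ γ) ∧ᶠ (β ⇒ γ))
  -□∧  : ∀ {α β} → Distribute - (□ (α ∧ᶠ β)) (□ α ∧ᶠ □ β)
  -↓∧  : ∀ {x α β} → Distribute - (↓[ x ] (α ∧ᶠ β)) (↓[ x ] α ∧ᶠ ↓[ x ] β)
  -at∧ : ∀ {t α β} → Distribute - (at[ t ] (α ∧ᶠ β)) (at[ t ] α ∧ᶠ at[ t ] β)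
  +¬∧  : ∀ {α β} → Distribute + (¬ᶠ (α ∧ᶠ β)) (¬ᶠ α ∨ᶠ ¬ᶠ β)
  -∨∧ʳ : ∀ {α β γ} → Distribute - (α ∨ᶠ (β ∧ᶠ γ)) ((α ∨ᶠ β) ∧ᶠ (α ∨ᶠ γ))
  -∨∧ˡ : ∀ {α β γ} → Distribute - ((α ∧ᶠ β) ∨ᶠ γ) ((α ∨ᶠ γ) ∧ᶠ (β ∨ᶠ γ))
  -⇒∧  : ∀ {α β γ} → Distribute - (α ⇒ (β ∧ᶠ γ)) ((α ⇒ β) ∧ᶠ (α ⇒ γ))
  in-¬  : ∀ {s α α′} → Distribute (opposite s) α α′ → Distribute s (¬ᶠ α) (¬ᶠ α′)
  in-∨ˡ : ∀ {s α α′ β} → Distribute s α α′ → Distribute s (α ∨ᶠ β) (α′ ∨ᶠ β)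
  in-∨ʳ : ∀ {s α β β′} → Distribute s β β′ → Distribute s (α ∨ᶠ β) (α ∨ᶠ β′)
  in-∧ˡ : ∀ {s α α′ β} → Distribute s α α′ → Distribute s (α ∧ᶠ β) (α′ ∧ᶠ β)
  in-∧ʳ : ∀ {s α β β′} → Distribute s β β′ → Distribute s (α ∧ᶠ β) (α ∧ᶠ β′)
  in-⇒ˡ : ∀ {s α α′ β} → Distribute (opposite s) α α′ → Distribute s (α ⇒ β) (α′ ⇒ β)
  in-⇒ʳ : ∀ {s α β β′} → Distribute s β β′ → Distribute s (α ⇒ β) (α ⇒ β′)
  in-◇  : ∀ {s α α′} → Distribute s α α′ → Distribute s (◇ α) (◇ α′)
  in-□  : ∀ {s α α′} → Distribute s α α′ → Distribute s (□ α) (□ α′)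
  in-at : ∀ {s t α α′} → Distribute s α α′ → Distribute s (at[ t ] α) (at[ t ] α′)
  in-↓  : ∀ {s x α α′} → Distribute s α α′ → Distribute s (↓[ x ] α) (↓[ x ] α′)

-- In the elimination rules p is required to occur: otherwise the rule would
-- replace an inequality by itself and no system would ever be exhausted.
data PreRule : Ineq → System → Set where
  distˡ  : ∀ {α α′ β} → Distribute + α α′ → PreRule (α ≼ β) ((α′ ≼ β) ∷ [])
  distʳ  : ∀ {α β β′} → Distribute - β β′ → PreRule (α ≼ β) ((α ≼ β′) ∷ [])
  split∨ : ∀ {α β γ} → PreRule (α ∨ᶠ β ≼ γ) ((α ≼ γ) ∷ (β ≼ γ) ∷ [])
  split∧ : ∀ {α β γ} → PreRule (α ≼ β ∧ᶠ γ) ((α ≼ β) ∷ (α ≼ γ) ∷ [])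
  elim⊥  : ∀ {α β} p → prop p occursInIneq (α ≼ β) → Negative p α → Positive p β →
           PreRule (α ≼ β) ((α ^ [ ⊥ᶠ /ᵖ p ] ≼ β ^ [ ⊥ᶠ /ᵖ p ]) ∷ [])
  elim⊤  : ∀ {α β} p → prop p occursInIneq (β ≼ α) → Negative p α → Positive p β →
           PreRule (β ≼ α) ((β ^ [ ⊤ᶠ /ᵖ p ] ≼ α ^ [ ⊤ᶠ /ᵖ p ]) ∷ [])

Preprocess : Form → Form → System → Set
Preprocess φ ψ S =
  Star (Replace PreRule) ((φ ≼ ψ) ∷ []) S × IsNormalForm (Replace PreRule) S

-- The parameter S is the whole system, needed for freshness only.
data ReduceRule (S : System) : Ineq → System → Set where
  split∧ : ∀ {i β γ} → ReduceRule S (tm (nom i) ≼ β ∧ᶠ γ)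
             ((tm (nom i) ≼ β) ∷ (tm (nom i) ≼ γ) ∷ [])
  split∨ : ∀ {i α β} → ReduceRule S (α ∨ᶠ β ≼ ¬ᶠ tm (nom i))
             ((α ≼ ¬ᶠ tm (nom i)) ∷ (β ≼ ¬ᶠ tm (nom i)) ∷ [])
  approx◇ : ∀ {s α j} → FreshNom j S → ReduceRule S (tm s ≼ ◇ α)
             ((tm (nom j) ≼ α) ∷ (tm s ≼ ◇ tm (nom j)) ∷ [])
  approx□ : ∀ {s α j} → FreshNom j S → ReduceRule S (□ α ≼ ¬ᶠ tm s)
             ((α ≼ ¬ᶠ tm (nom j)) ∷ (□ ¬ᶠ tm (nom j) ≼ ¬ᶠ tm s) ∷ [])
  approx-atˡ : ∀ {s t α} → ReduceRule S (tm s ≼ at[ t ] α) ((tm t ≼ α) ∷ [])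
  approx-atʳ : ∀ {s t α} → ReduceRule S (at[ t ] α ≼ ¬ᶠ tm s) ((α ≼ ¬ᶠ tm t) ∷ [])
  approx↓ˡ : ∀ {s x α α′} → α [ [ s /ˢ x ] ]↝ α′ →
             ReduceRule S (tm s ≼ ↓[ x ] α) ((tm s ≼ α′) ∷ [])
  approx↓ʳ : ∀ {s x α α′} → α [ [ s /ˢ x ] ]↝ α′ →
             ReduceRule S (↓[ x ] α ≼ ¬ᶠ tm s) ((α′ ≼ ¬ᶠ tm s) ∷ [])
  approx⇒ : ∀ {s α β j k} → FreshNom j S → FreshNom k S → j ≢ k →
             ReduceRule S (α ⇒ β ≼ ¬ᶠ tm s)
             ((tm (nom j) ≼ α) ∷ (β ≼ ¬ᶠ tm (nom k)) ∷
              (tm (nom j) ⇒ ¬ᶠ tm (nom k) ≼ ¬ᶠ tm s) ∷ [])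
  resid¬ˡ : ∀ {s α} → ReduceRule S (tm s ≼ ¬ᶠ α) ((α ≼ ¬ᶠ tm s) ∷ [])
  resid¬ʳ : ∀ {s α} → ReduceRule S (¬ᶠ α ≼ ¬ᶠ tm s) ((tm s ≼ α) ∷ [])

ReduceStep : System → System → Set
ReduceStep S = Replace (ReduceRule S) S

-- (t , γ) stands for t ≤ γ, and (β , u) for β ≤ ¬u.
lowers : List (Term × Form) → System
lowers = map (λ (t , γ) → tm t ≼ γ)

uppers : List (Form × Term) → System
uppers = map (λ (β , u) → β ≼ ¬ᶠ tm u)

SubstLowers : Subst → List (Term × Form) → List (Term × Form) → Set
SubstLowers σ = Pointwise (λ (t , γ) (t′ , γ′) → t ≡ t′ × γ [ σ ]↝ γ′)

SubstUppers : Subst → List (Form × Term) → List (Form × Term) → Set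
SubstUppers σ = Pointwise (λ (β , u) (β′ , u′) → β [ σ ]↝ β′ × u ≡ u′)

data AckermannStep : System → System → Set where
  right : ∀ {S p ss γs γs′ βs βs′} →
    S ∼[ set ] map (λ s → tm s ≼ var p) ss ++ lowers γs ++ uppers βs →
    All (Negative p ∘ proj₂) γs → All (Positive p ∘ proj₁) βs →
    let σ = [ ⋁ (map tm ss) /ᵖ p ] in
    SubstLowers σ γs γs′ → SubstUppers σ βs βs′ →
    AckermannStep S (lowers γs′ ++ uppers βs′)
  left : ∀ {S p ss γs γs′ βs βs′} →
    S ∼[ set ] map (λ s → var p ≼ ¬ᶠ tm s) ss ++ lowers γs ++ uppers βs →
    All (Positive p ∘ proj₂) γs → All (Negative p ∘ proj₁) βs →
    let σ = [ ⋀ (map (λ s → ¬ᶠ tm s) ss) /ᵖ p ] in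
    SubstLowers σ γs γs′ → SubstUppers σ βs βs′ →
    AckermannStep S (lowers γs′ ++ uppers βs′)

Reduce : System → System → Set
Reduce S T = ∃[ M ] (Star ReduceStep S M × Star AckermannStep M T × All PureIneq T)

svarsTo : (Svar → Nom) → Subst
onProp (svarsTo ν)          = var
onTerm (svarsTo ν) (nom i)  = nom i
onTerm (svarsTo ν) (svar x) = nom (ν x)

substIneq : Subst → Ineq → Ineq
substIneq σ (α ≼ β) = α ^ σ ≼ β ^ σ

substQuasi : Subst → Quasi → Quasi
substQuasi σ (& S ⟹ e) = & map (substIneq σ) S ⟹ substIneq σ e

-- PureOutput φ ψ Qs: some successful run of the (non-deterministic) algorithm
-- on φ → ψ outputs the set Qs.
record PureOutput (φ ψ : Form) (Qs : List Quasi) : Set where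
  field
    preprocessed  : System
    isPreprocess  : Preprocess φ ψ preprocessed
    i₀ i₁         : Nom
    i₀≢i₁         : i₀ ≢ i₁
    i₀-fresh      : FreshNom i₀ preprocessed
    i₁-fresh      : FreshNom i₁ preprocessed

  approximate : Ineq → System
  approximate (φᵢ ≼ ψᵢ) = (tm (nom i₀) ≼ φᵢ) ∷ (ψᵢ ≼ ¬ᶠ tm (nom i₁)) ∷ []

  field
    reduced       : List System
    isReduced     : Pointwise (λ e T → Reduce (approximate e) T) preprocessed reduced

  quasis : List Quasi
  quasis = map (λ T → & T ⟹ (tm (nom i₀) ≼ ¬ᶠ tm (nom i₁))) reduced

  field
    ν             : Svar → Nom
    ν-injective   : Injective _≡_ _≡_ ν
    ν-fresh       : ∀ x → All (λ (& T ⟹ e) → FreshNom (ν x) (e ∷ T)) quasis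
    output        : Qs ≡ map (substQuasi (svarsTo ν)) quasis

data Tr : Ineq → Form → Set where
  lower : ∀ {s γ} → Tr (tm s ≼ γ) (at[ s ] γ)
  upper : ∀ {s γ} → Tr (γ ≼ ¬ᶠ tm s) (¬ᶠ at[ s ] γ)

-- The order in which the members of a finite set are conjoined is left open,
-- as is the choice between the two forms for each inequality.
data TrQuasi : Quasi → Form → Set where
  tr : ∀ {S L χs i j} → S ∼[ set ] L → Pointwise Tr L χs →
       TrQuasi (& S ⟹ (tm (nom i) ≼ ¬ᶠ tm (nom j)))
               (⋀ χs ⇒ ¬ᶠ at[ nom i ] tm (nom j))

data TrSet : List Quasi → Form → Set where
  tr : ∀ {Qs L χs} → Qs ∼[ set ] L → Pointwise TrQuasi L χs → TrSet Qs (⋀ χs)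

{-# OPTIONS --safe #-}
-- Call a system S good if the conjunction of the translations of its members
-- provably implies ¬ @i₀ i₁. If α → β is provable, {i₀ ≤ α, β ≤ ¬ i₁} is good.
-- A reduction rule keeps a system good because the translations of the new
-- inequalities provably imply that of the old one; an Ackermann step keeps it
-- good because it is an instance of the substitution rule under which the
-- translations of the discarded inequalities become theorems. Equality up to
-- renaming of bound variables is provable equivalence, by DA together with the
-- Name rule: from ⊢ @i α with i fresh infer ⊢ α, by replacing i with a fresh
-- state variable x and applying Name↓ to ↓x.@x α.

module Submission where

open import Defs
open import Data.Bool.Base using (Bool; true; false; not; _∧_; _∨_; T)
open import Data.Bool.Properties using (T-≡; T-∧)
open import Data.Fin.Base using (Fin)
open import Data.Fin.Patterns using (0F; 1F; 2F; 3F; 4F; 5F)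
open import Data.List.Base using (List; []; _∷_; map)
open import Data.List.Membership.Propositional using (_∈_)
open import Data.List.Membership.Propositional.Properties
  using (∈-map⁺; ∈-map⁻; ∈-++⁺ˡ; ∈-++⁺ʳ)
open import Data.List.Relation.Binary.BagAndSetEquality using (_∼[_]_; set)
open import Data.List.Relation.Binary.Pointwise using (Pointwise; []; _∷_)
open import Data.List.Relation.Unary.All as All using (All; []; _∷_)
import Data.List.Relation.Unary.All.Properties as All
open import Data.List.Relation.Unary.Any using (here; there)
open import Data.Nat.Base using (ℕ; zero; suc; _⊔_; _≤_)
open import Data.Nat.Properties using (_≟_; ≤-refl; ≤-trans; m≤m⊔n; m≤n⊔m; 1+n≰n)
open import Data.Product.Base using (∃-syntax; _×_; _,_; proj₁; proj₂)
open import Data.Sum.Base using (_⊎_; inj₁; inj₂)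
open import Data.Unit.Base using (tt)
open import Data.Vec.Base as Vec using (Vec; []; _∷_)
import Data.Vec.Recursive as Rec
open import Data.Vec.Properties using (lookup-map)
open import Function.Base using (_∘_)
open import Function.Bundles using (Equivalence)
open import Relation.Binary.Construct.Closure.ReflexiveTransitive using (Star; ε; _◅_)
open import Relation.Binary.PropositionalEquality
  using (_≡_; _≢_; refl; sym; trans; cong; cong₂)
  renaming (subst to transport; subst₂ to transport₂)
open import Relation.Nullary.Decidable using (yes; no)
open import Relation.Nullary.Negation using (¬_; contradiction)

-- Occurrences and fresh indices

freeIn⇒occursIn : ∀ {a} α → a freeIn α → a occursIn α
freeIn⇒occursIn (var p)      h        = h
freeIn⇒occursIn (tm t)       h        = h
freeIn⇒occursIn (¬ᶠ α)       h        = freeIn⇒occursIn α h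
freeIn⇒occursIn (α ∨ᶠ β)     (inj₁ h) = inj₁ (freeIn⇒occursIn α h)
freeIn⇒occursIn (α ∨ᶠ β)     (inj₂ h) = inj₂ (freeIn⇒occursIn β h)
freeIn⇒occursIn (α ∧ᶠ β)     (inj₁ h) = inj₁ (freeIn⇒occursIn α h)
freeIn⇒occursIn (α ∧ᶠ β)     (inj₂ h) = inj₂ (freeIn⇒occursIn β h)
freeIn⇒occursIn (α ⇒ β)      (inj₁ h) = inj₁ (freeIn⇒occursIn α h)
freeIn⇒occursIn (α ⇒ β)      (inj₂ h) = inj₂ (freeIn⇒occursIn β h)
freeIn⇒occursIn (◇ α)        h        = freeIn⇒occursIn α h
freeIn⇒occursIn (□ α)        h        = freeIn⇒occursIn α h
freeIn⇒occursIn (at[ t ] α)  (inj₁ h) = inj₁ h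
freeIn⇒occursIn (at[ t ] α)  (inj₂ h) = inj₂ (freeIn⇒occursIn α h)
freeIn⇒occursIn (↓[ x ] α)   (_ , h)  = inj₂ (freeIn⇒occursIn α h)

index : Term → ℕ
index (nom i)  = i
index (svar x) = x

maxIndex : Form → ℕ
maxIndex (var p)     = 0
maxIndex (tm t)      = index t
maxIndex ⊥ᶠ          = 0
maxIndex ⊤ᶠ          = 0
maxIndex (¬ᶠ α)      = maxIndex α
maxIndex (α ∨ᶠ β)    = maxIndex α ⊔ maxIndex β
maxIndex (α ∧ᶠ β)    = maxIndex α ⊔ maxIndex β
maxIndex (α ⇒ β)     = maxIndex α ⊔ maxIndex β
maxIndex (◇ α)       = maxIndex α
maxIndex (□ α)       = maxIndex α
maxIndex (at[ t ] α) = index t ⊔ maxIndex α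
maxIndex (↓[ x ] α)  = x ⊔ maxIndex α

occursIn⇒≤maxIndex : ∀ {t} α → term t occursIn α → index t ≤ maxIndex α
occursIn⇒≤maxIndex (tm t)      refl        = ≤-refl
occursIn⇒≤maxIndex (¬ᶠ α)      h           = occursIn⇒≤maxIndex α h
occursIn⇒≤maxIndex (α ∨ᶠ β)    (inj₁ h)    = ≤-trans (occursIn⇒≤maxIndex α h) (m≤m⊔n _ _)
occursIn⇒≤maxIndex (α ∨ᶠ β)    (inj₂ h)    = ≤-trans (occursIn⇒≤maxIndex β h) (m≤n⊔m (maxIndex α) _)
occursIn⇒≤maxIndex (α ∧ᶠ β)    (inj₁ h)    = ≤-trans (occursIn⇒≤maxIndex α h) (m≤m⊔n _ _)
occursIn⇒≤maxIndex (α ∧ᶠ β)    (inj₂ h)    = ≤-trans (occursIn⇒≤maxIndex β h) (m≤n⊔m (maxIndex α) _)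
occursIn⇒≤maxIndex (α ⇒ β)     (inj₁ h)    = ≤-trans (occursIn⇒≤maxIndex α h) (m≤m⊔n _ _)
occursIn⇒≤maxIndex (α ⇒ β)     (inj₂ h)    = ≤-trans (occursIn⇒≤maxIndex β h) (m≤n⊔m (maxIndex α) _)
occursIn⇒≤maxIndex (◇ α)       h           = occursIn⇒≤maxIndex α h
occursIn⇒≤maxIndex (□ α)       h           = occursIn⇒≤maxIndex α h
occursIn⇒≤maxIndex (at[ t ] α) (inj₁ refl) = m≤m⊔n _ _
occursIn⇒≤maxIndex (at[ t ] α) (inj₂ h)    = ≤-trans (occursIn⇒≤maxIndex α h) (m≤n⊔m (index t) _)
occursIn⇒≤maxIndex (↓[ x ] α)  (inj₁ refl) = m≤m⊔n _ _
occursIn⇒≤maxIndex (↓[ x ] α)  (inj₂ h)    = ≤-trans (occursIn⇒≤maxIndex α h) (m≤n⊔m x _)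

-- `maxIndex` bounds nominals and state variables together, so this one number is fresh in both
-- sorts; `name` uses it in both at once.
fresh : Form → ℕ
fresh α = suc (maxIndex α)

nom-fresh : ∀ α → ¬ (term (nom (fresh α)) occursIn α)
nom-fresh α h = 1+n≰n (occursIn⇒≤maxIndex α h)

svar-fresh : ∀ α → ¬ (term (svar (fresh α)) occursIn α)
svar-fresh α h = 1+n≰n (occursIn⇒≤maxIndex α h)

-- Substitution

image-≔-hit : ∀ σ x {s} → image (σ [ x ≔ s ]ˢ) (term (svar x)) ≡ tm s
image-≔-hit σ x with x ≟ x
... | yes _  = refl
... | no x≢x = contradiction refl x≢x

image-≔-miss : ∀ σ x {s} a → a ≢ term (svar x) → image (σ [ x ≔ s ]ˢ) a ≡ image σ a
image-≔-miss σ x (prop p)        a≢x = refl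
image-≔-miss σ x (term (nom i))  a≢x = refl
image-≔-miss σ x (term (svar y)) a≢x with y ≟ x
... | yes refl = contradiction refl a≢x
... | no  _    = refl

svar-dec : ∀ a x → a ≡ term (svar x) ⊎ a ≢ term (svar x)
svar-dec (prop p)        x = inj₂ λ ()
svar-dec (term (nom i))  x = inj₂ λ ()
svar-dec (term (svar y)) x with y ≟ x
... | yes refl = inj₁ refl
... | no  y≢x  = inj₂ λ { refl → y≢x refl }

-- A sufficient condition for `Safe` that ignores scopes and therefore passes to subformulas. The
-- exception `a ≡ term (svar z)` is harmless: such an `a` is not free in a formula that begins with
-- a binder of `z`.
NonCapturing : Subst → Form → Set
NonCapturing σ α = ∀ a z → a freeIn α → term (svar z) occursIn α →
                   term (svar z) freeIn image σ a → a ≡ term (svar z)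

nonCapturing⇒safe : ∀ α {σ} → NonCapturing σ α → Safe σ α
nonCapturing⇒safe (var p)     h = tt
nonCapturing⇒safe (tm t)      h = tt
nonCapturing⇒safe ⊥ᶠ          h = tt
nonCapturing⇒safe ⊤ᶠ          h = tt
nonCapturing⇒safe (¬ᶠ α)      h = nonCapturing⇒safe α h
nonCapturing⇒safe (α ∨ᶠ β)    h = nonCapturing⇒safe α (λ a z f o → h a z (inj₁ f) (inj₁ o)) ,
                                  nonCapturing⇒safe β (λ a z f o → h a z (inj₂ f) (inj₂ o))
nonCapturing⇒safe (α ∧ᶠ β)    h = nonCapturing⇒safe α (λ a z f o → h a z (inj₁ f) (inj₁ o)) ,
                                  nonCapturing⇒safe β (λ a z f o → h a z (inj₂ f) (inj₂ o))
nonCapturing⇒safe (α ⇒ β)     h = nonCapturing⇒safe α (λ a z f o → h a z (inj₁ f) (inj₁ o)) ,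
                                  nonCapturing⇒safe β (λ a z f o → h a z (inj₂ f) (inj₂ o))
nonCapturing⇒safe (◇ α)       h = nonCapturing⇒safe α h
nonCapturing⇒safe (□ α)       h = nonCapturing⇒safe α h
nonCapturing⇒safe (at[ t ] α) h = nonCapturing⇒safe α (λ a z f o → h a z (inj₂ f) (inj₂ o))
nonCapturing⇒safe (↓[ x ] α) {σ} h =
  (λ a f g → proj₁ f (h a x f (inj₁ refl) g)) , nonCapturing⇒safe α under
  where
  under : NonCapturing (σ [ x ≔ svar x ]ˢ) α
  under a z f o g with svar-dec a x
  ... | inj₁ refl = sym (transport (term (svar z) freeIn_) (image-≔-hit σ x) g)
  ... | inj₂ a≢x  = h a z (a≢x , f) (inj₂ o)
                      (transport (term (svar z) freeIn_) (image-≔-miss σ x a a≢x) g)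

Fixes : Subst → Form → Set
Fixes σ α = ∀ a → a freeIn α → image σ a ≡ image idˢ a

freeIn-image-idˢ : ∀ {a} b → a freeIn image idˢ b → a ≡ b
freeIn-image-idˢ (prop p) h = h
freeIn-image-idˢ (term t) h = h

fixes⇒safe : ∀ α {σ} → Fixes σ α → Safe σ α
fixes⇒safe α h = nonCapturing⇒safe α λ a z f _ g →
  sym (freeIn-image-idˢ a (transport (term (svar z) freeIn_) (h a f) g))

tm-injective : ∀ {s t} → tm s ≡ tm t → s ≡ t
tm-injective refl = refl

fixes⇒^-id : ∀ α {σ} → Fixes σ α → α ^ σ ≡ α
fixes⇒^-id (var p)     h = h (prop p) refl
fixes⇒^-id (tm t)      h = h (term t) refl
fixes⇒^-id ⊥ᶠ          h = refl
fixes⇒^-id ⊤ᶠ          h = refl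
fixes⇒^-id (¬ᶠ α)      h = cong ¬ᶠ_ (fixes⇒^-id α h)
fixes⇒^-id (α ∨ᶠ β)    h = cong₂ _∨ᶠ_ (fixes⇒^-id α (λ a → h a ∘ inj₁)) (fixes⇒^-id β (λ a → h a ∘ inj₂))
fixes⇒^-id (α ∧ᶠ β)    h = cong₂ _∧ᶠ_ (fixes⇒^-id α (λ a → h a ∘ inj₁)) (fixes⇒^-id β (λ a → h a ∘ inj₂))
fixes⇒^-id (α ⇒ β)     h = cong₂ _⇒_ (fixes⇒^-id α (λ a → h a ∘ inj₁)) (fixes⇒^-id β (λ a → h a ∘ inj₂))
fixes⇒^-id (◇ α)       h = cong ◇_ (fixes⇒^-id α h)
fixes⇒^-id (□ α)       h = cong □_ (fixes⇒^-id α h)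
fixes⇒^-id (at[ t ] α) h =
  cong₂ at[_]_ (tm-injective (h (term t) (inj₁ refl))) (fixes⇒^-id α (λ a → h a ∘ inj₂))
fixes⇒^-id (↓[ x ] α) {σ} h = cong ↓[ x ]_ (fixes⇒^-id α under)
  where
  under : Fixes (σ [ x ≔ svar x ]ˢ) α
  under a f with svar-dec a x
  ... | inj₁ refl = image-≔-hit σ x
  ... | inj₂ a≢x  = trans (image-≔-miss σ x a a≢x) (h a (a≢x , f))

Renaming : Subst → Set
Renaming σ = ∀ p → onProp σ p ≡ var p

target : Subst → Symbol → Symbol
target σ (prop p) = prop p
target σ (term t) = term (onTerm σ t)

image-renaming : ∀ {σ} → Renaming σ → ∀ a → image σ a ≡ image idˢ (target σ a)
image-renaming r (prop p) = r p
image-renaming r (term t) = refl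

target-≔-hit : ∀ σ x {s} → target (σ [ x ≔ s ]ˢ) (term (svar x)) ≡ term s
target-≔-hit σ x = cong term (tm-injective (image-≔-hit σ x))

target-≔-miss : ∀ σ x {s} a → a ≢ term (svar x) → target (σ [ x ≔ s ]ˢ) a ≡ target σ a
target-≔-miss σ x (prop p) a≢x = refl
target-≔-miss σ x (term t) a≢x = cong term (tm-injective (image-≔-miss σ x (term t) a≢x))

target-idˢ : ∀ a → target idˢ a ≡ a
target-idˢ (prop p) = refl
target-idˢ (term t) = refl

freeIn-^⁻ : ∀ α {σ} → Renaming σ → ∀ {b} → b freeIn (α ^ σ) →
            ∃[ a ] (a freeIn α × b ≡ target σ a)
freeIn-^⁻ (var p) {σ} r {b} h = prop p , refl , transport (b freeIn_) (r p) h
freeIn-^⁻ (tm t)      r h = term t , refl , h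
freeIn-^⁻ (¬ᶠ α)      r h = freeIn-^⁻ α r h
freeIn-^⁻ (α ∨ᶠ β)    r (inj₁ h) = let a , f , e = freeIn-^⁻ α r h in a , inj₁ f , e
freeIn-^⁻ (α ∨ᶠ β)    r (inj₂ h) = let a , f , e = freeIn-^⁻ β r h in a , inj₂ f , e
freeIn-^⁻ (α ∧ᶠ β)    r (inj₁ h) = let a , f , e = freeIn-^⁻ α r h in a , inj₁ f , e
freeIn-^⁻ (α ∧ᶠ β)    r (inj₂ h) = let a , f , e = freeIn-^⁻ β r h in a , inj₂ f , e
freeIn-^⁻ (α ⇒ β)     r (inj₁ h) = let a , f , e = freeIn-^⁻ α r h in a , inj₁ f , e
freeIn-^⁻ (α ⇒ β)     r (inj₂ h) = let a , f , e = freeIn-^⁻ β r h in a , inj₂ f , e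
freeIn-^⁻ (◇ α)       r h = freeIn-^⁻ α r h
freeIn-^⁻ (□ α)       r h = freeIn-^⁻ α r h
freeIn-^⁻ (at[ t ] α) r (inj₁ h) = term t , inj₁ refl , h
freeIn-^⁻ (at[ t ] α) r (inj₂ h) = let a , f , e = freeIn-^⁻ α r h in a , inj₂ f , e
freeIn-^⁻ (↓[ x ] α) {σ} r (b≢x , h) with freeIn-^⁻ α r h
... | a , f , e with svar-dec a x
...   | inj₁ refl = contradiction (trans e (target-≔-hit σ x)) b≢x
...   | inj₂ a≢x  = a , (a≢x , f) , trans e (target-≔-miss σ x a a≢x)

-- Agreement on the free symbols only, so that a detour through a fresh name can be compared with
-- the direct substitution `ρ`.
Composes : Subst → Subst → Subst → Form → Set
Composes σ τ ρ α = ∀ a → a freeIn α → image τ (target σ a) ≡ image ρ a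

-- Under the binder all three substitutions are reset at `x`. For `τ` the reset is harmless because
-- safety of `σ` keeps the target of any other free symbol different from `x`.
composes-under : ∀ x α {σ τ ρ} → Renaming σ → Safe σ (↓[ x ] α) → Composes σ τ ρ (↓[ x ] α) →
  Composes (σ [ x ≔ svar x ]ˢ) (τ [ x ≔ svar x ]ˢ) (ρ [ x ≔ svar x ]ˢ) α
composes-under x α {σ} {τ} {ρ} r (safe , _) h a f with svar-dec a x
... | inj₁ refl = trans (cong (image (τ [ x ≔ svar x ]ˢ)) (target-≔-hit σ x))
                        (trans (image-≔-hit τ x) (sym (image-≔-hit ρ x)))
... | inj₂ a≢x  = trans (cong (image (τ [ x ≔ svar x ]ˢ)) (target-≔-miss σ x a a≢x))
                 (trans (image-≔-miss τ x (target σ a) target≢x)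
                 (trans (h a (a≢x , f)) (sym (image-≔-miss ρ x a a≢x))))
  where
  target≢x : target σ a ≢ term (svar x)
  target≢x e = safe a (a≢x , f)
    (transport (term (svar x) freeIn_) (sym (trans (image-renaming r a) (cong (image idˢ) e))) refl)

^-compose : ∀ α {σ τ ρ} → Renaming σ → Safe σ α → Composes σ τ ρ α → (α ^ σ) ^ τ ≡ α ^ ρ
^-compose (var p) {σ} {τ} r s h = trans (cong (_^ τ) (r p)) (h (prop p) refl)
^-compose (tm t)      r s h = h (term t) refl
^-compose ⊥ᶠ          r s h = refl
^-compose ⊤ᶠ          r s h = refl
^-compose (¬ᶠ α)      r s h = cong ¬ᶠ_ (^-compose α r s h)
^-compose (α ∨ᶠ β)    r (s , s′) h = cong₂ _∨ᶠ_ (^-compose α r s (λ a → h a ∘ inj₁)) (^-compose β r s′ (λ a → h a ∘ inj₂))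
^-compose (α ∧ᶠ β)    r (s , s′) h = cong₂ _∧ᶠ_ (^-compose α r s (λ a → h a ∘ inj₁)) (^-compose β r s′ (λ a → h a ∘ inj₂))
^-compose (α ⇒ β)     r (s , s′) h = cong₂ _⇒_ (^-compose α r s (λ a → h a ∘ inj₁)) (^-compose β r s′ (λ a → h a ∘ inj₂))
^-compose (◇ α)       r s h = cong ◇_ (^-compose α r s h)
^-compose (□ α)       r s h = cong □_ (^-compose α r s h)
^-compose (at[ t ] α) r s h =
  cong₂ at[_]_ (tm-injective (h (term t) (inj₁ refl))) (^-compose α r s (λ a → h a ∘ inj₂))
^-compose (↓[ x ] α)  r s h = cong ↓[ x ]_ (^-compose α r (proj₂ s) (composes-under x α r s h))

-- Every free symbol of `α ^ σ` is the target of a free symbol of `α`, and `τ` sends it where `ρ`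
-- sends the latter. A capture by `τ` would thus already be one by `ρ`.
safe-compose : ∀ α {σ τ ρ} → Renaming σ → Safe σ α → Safe ρ α → Composes σ τ ρ α → Safe τ (α ^ σ)
safe-compose (var p) {σ} {τ} r s _ h = transport (Safe τ) (sym (r p)) tt
safe-compose (tm t)      r s _ h = tt
safe-compose ⊥ᶠ          r s _ h = tt
safe-compose ⊤ᶠ          r s _ h = tt
safe-compose (¬ᶠ α)      r s u h = safe-compose α r s u h
safe-compose (α ∨ᶠ β)    r (s , s′) (u , u′) h = safe-compose α r s u (λ a → h a ∘ inj₁) , safe-compose β r s′ u′ (λ a → h a ∘ inj₂)
safe-compose (α ∧ᶠ β)    r (s , s′) (u , u′) h = safe-compose α r s u (λ a → h a ∘ inj₁) , safe-compose β r s′ u′ (λ a → h a ∘ inj₂)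
safe-compose (α ⇒ β)     r (s , s′) (u , u′) h = safe-compose α r s u (λ a → h a ∘ inj₁) , safe-compose β r s′ u′ (λ a → h a ∘ inj₂)
safe-compose (◇ α)       r s u h = safe-compose α r s u h
safe-compose (□ α)       r s u h = safe-compose α r s u h
safe-compose (at[ t ] α) r s u h = safe-compose α r s u (λ a → h a ∘ inj₂)
safe-compose (↓[ x ] α) {σ} {τ} r s (u , u′) h =
  avoids , safe-compose α r (proj₂ s) u′ (composes-under x α r s h)
  where
  avoids : ∀ b → b freeIn ((↓[ x ] α) ^ σ) → ¬ (term (svar x) freeIn image τ b)
  avoids b f g with freeIn-^⁻ (↓[ x ] α) r f
  ... | a , f′ , refl = u a f′ (transport (term (svar x) freeIn_) (h a f′) g)

-- Replacing a nominal by a term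

[_/ⁿ_] : Term → Nom → Subst
onProp [ s /ⁿ i ] = var
onTerm [ s /ⁿ i ] (svar x) = svar x
onTerm [ s /ⁿ i ] (nom j) with j ≟ i
... | yes _ = s
... | no  _ = nom j

/ⁿ-hit : ∀ s i → onTerm [ s /ⁿ i ] (nom i) ≡ s
/ⁿ-hit s i with i ≟ i
... | yes _  = refl
... | no i≢i = contradiction refl i≢i

/ⁿ-miss : ∀ s i a → a ≢ term (nom i) → image [ s /ⁿ i ] a ≡ image idˢ a
/ⁿ-miss s i (prop p)        a≢i = refl
/ⁿ-miss s i (term (svar x)) a≢i = refl
/ⁿ-miss s i (term (nom j))  a≢i with j ≟ i
... | yes refl = contradiction refl a≢i
... | no  _    = refl

/ⁿ-fixes : ∀ s i α → ¬ (term (nom i) occursIn α) → Fixes [ s /ⁿ i ] α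
/ⁿ-fixes s i α i∉α a f = /ⁿ-miss s i a λ { refl → i∉α (freeIn⇒occursIn α f) }

-- The variable `x` travels through `i` to `s`; freshness of `i` means that the second substitution
-- moves nothing else.
/ˢ-fresh-nom-composes : ∀ s i x α → ¬ (term (nom i) occursIn α) →
  Composes [ nom i /ˢ x ] [ s /ⁿ i ] [ s /ˢ x ] α
/ˢ-fresh-nom-composes s i x α i∉α a f with svar-dec a x
... | inj₁ refl = trans (cong (image [ s /ⁿ i ]) (target-≔-hit idˢ x))
                 (trans (cong tm (/ⁿ-hit s i)) (sym (image-≔-hit idˢ x)))
... | inj₂ a≢x  = trans (cong (image [ s /ⁿ i ]) (trans (target-≔-miss idˢ x a a≢x) (target-idˢ a)))
                 (trans (/ⁿ-fixes s i α i∉α a f) (sym (image-≔-miss idˢ x a a≢x)))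

/ˢ-fresh-svar-composes : ∀ s y x α → ¬ (term (svar y) occursIn α) →
  Composes [ svar y /ˢ x ] [ s /ˢ y ] [ s /ˢ x ] α
/ˢ-fresh-svar-composes s y x α y∉α a f with svar-dec a x
... | inj₁ refl = trans (cong (image [ s /ˢ y ]) (target-≔-hit idˢ x))
                 (trans (image-≔-hit idˢ y) (sym (image-≔-hit idˢ x)))
... | inj₂ a≢x  = trans (cong (image [ s /ˢ y ]) (trans (target-≔-miss idˢ x a a≢x) (target-idˢ a)))
                 (trans (image-≔-miss idˢ y a λ { refl → y∉α (freeIn⇒occursIn α f) })
                        (sym (image-≔-miss idˢ x a a≢x)))

/ˢ-nom-safe : ∀ i x α → Safe [ nom i /ˢ x ] α
/ˢ-nom-safe i x α = nonCapturing⇒safe α λ a z f o g → go a z g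
  where
  go : ∀ a z → term (svar z) freeIn image [ nom i /ˢ x ] a → a ≡ term (svar z)
  go a z g with svar-dec a x
  ... | inj₁ refl = contradiction (transport (term (svar z) freeIn_) (image-≔-hit idˢ x) g) λ ()
  ... | inj₂ a≢x  = sym (freeIn-image-idˢ a (transport (term (svar z) freeIn_) (image-≔-miss idˢ x a a≢x) g))

/ˢ-fresh-svar-safe : ∀ y x α → ¬ (term (svar y) occursIn α) → Safe [ svar y /ˢ x ] α
/ˢ-fresh-svar-safe y x α y∉α = nonCapturing⇒safe α go
  where
  go : NonCapturing [ svar y /ˢ x ] α
  go a z f o g with svar-dec a x
  ... | inj₁ refl with transport (term (svar z) freeIn_) (image-≔-hit idˢ x) g
  ...   | refl = contradiction o y∉α
  go a z f o g | inj₂ a≢x =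
    sym (freeIn-image-idˢ a (transport (term (svar z) freeIn_) (image-≔-miss idˢ x a a≢x) g))

-- Propositional reasoning

infix  9 ~_
infixr 7 _⊓_
infixr 6 _⊔ˢ_
infixr 5 _⊃_ _⊃⊂_

-- Proof by reflection: Boolean schemes whose truth tables are computed during type checking.
data Schema (n : ℕ) : Set where
  atom           : Fin n → Schema n
  ~_             : Schema n → Schema n
  _⊓_ _⊔ˢ_ _⊃_   : Schema n → Schema n → Schema n

pattern A = atom 0F
pattern B = atom 1F
pattern C = atom 2F
pattern D = atom 3F
pattern E = atom 4F

_⊃⊂_ : ∀ {n} → Schema n → Schema n → Schema n
F ⊃⊂ G = (F ⊃ G) ⊓ (G ⊃ F)

⟦_⟧ : ∀ {n} → Schema n → Vec Form n → Form
⟦ atom i ⟧   ρ = Vec.lookup ρ i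
⟦ ~ F ⟧      ρ = ¬ᶠ ⟦ F ⟧ ρ
⟦ F ⊓ G ⟧    ρ = ⟦ F ⟧ ρ ∧ᶠ ⟦ G ⟧ ρ
⟦ F ⊔ˢ G ⟧   ρ = ⟦ F ⟧ ρ ∨ᶠ ⟦ G ⟧ ρ
⟦ F ⊃ G ⟧    ρ = ⟦ F ⟧ ρ ⇒ ⟦ G ⟧ ρ

truth : ∀ {n} → Schema n → Vec Bool n → Bool
truth (atom i) bs = Vec.lookup bs i
truth (~ F)    bs = not (truth F bs)
truth (F ⊓ G)  bs = truth F bs ∧ truth G bs
truth (F ⊔ˢ G) bs = truth F bs ∨ truth G bs
truth (F ⊃ G)  bs = not (truth F bs) ∨ truth G bs

eval-⟦⟧ : ∀ {n} (F : Schema n) v ρ → eval v (⟦ F ⟧ ρ) ≡ truth F (Vec.map (eval v) ρ)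
eval-⟦⟧ (atom i) v ρ = sym (lookup-map i (eval v) ρ)
eval-⟦⟧ (~ F)    v ρ = cong not (eval-⟦⟧ F v ρ)
eval-⟦⟧ (F ⊓ G)  v ρ = cong₂ _∧_ (eval-⟦⟧ F v ρ) (eval-⟦⟧ G v ρ)
eval-⟦⟧ (F ⊔ˢ G) v ρ = cong₂ _∨_ (eval-⟦⟧ F v ρ) (eval-⟦⟧ G v ρ)
eval-⟦⟧ (F ⊃ G)  v ρ = cong₂ (λ b c → not b ∨ c) (eval-⟦⟧ F v ρ) (eval-⟦⟧ G v ρ)

everywhere : ∀ n → (Vec Bool n → Bool) → Bool
everywhere zero    f = f []
everywhere (suc n) f = everywhere n (λ bs → f (true ∷ bs)) ∧ everywhere n (λ bs → f (false ∷ bs))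

everywhere-sound : ∀ n f → T (everywhere n f) → ∀ bs → T (f bs)
everywhere-sound zero    f h []           = h
everywhere-sound (suc n) f h (true ∷ bs)  = everywhere-sound n _ (proj₁ (Equivalence.to T-∧ h)) bs
everywhere-sound (suc n) f h (false ∷ bs) =
  everywhere-sound n _ (proj₂ (Equivalence.to (T-∧ {everywhere n (λ bs → f (true ∷ bs))}) h)) bs

module _ {ax : Form} where

  infix  3 ⊢_
  infixl 4 _·_

  ⊢_ : Form → Set
  ⊢ α = ⊢[ ax ] α

  _·_ : ∀ {α β} → ⊢ α ⇒ β → ⊢ α → ⊢ β
  _·_ = MP

  -- Once the truth table evaluates to `true`, the first implicit argument has the unit type and is
  -- filled in. The recursive vector `ρ` is a nested product, so its components are found by
  -- unification with the expected formula.
  tautology : ∀ n (F : Schema n) {_ : T (everywhere n (truth F))} {ρ : Form Rec.^ n} →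
              ⊢ ⟦ F ⟧ (Rec.toVec n ρ)
  tautology n F {valid} {ρ} = axiom (taut λ v →
    trans (eval-⟦⟧ F v (Rec.toVec n ρ)) (Equivalence.to T-≡ (everywhere-sound n (truth F) valid _)))

  ⇒-refl : ∀ {α} → ⊢ α ⇒ α
  ⇒-refl = tautology 1 (A ⊃ A)

  ⇒-trans : ∀ {α β γ} → ⊢ α ⇒ β → ⊢ β ⇒ γ → ⊢ α ⇒ γ
  ⇒-trans h k = tautology 3 ((A ⊃ B) ⊃ (B ⊃ C) ⊃ A ⊃ C) · h · k

  const-⇒ : ∀ {α β} → ⊢ β → ⊢ α ⇒ β
  const-⇒ h = tautology 2 (A ⊃ B ⊃ A) · h

  ∧-proj₁ : ∀ {α β} → ⊢ α ∧ᶠ β ⇒ α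
  ∧-proj₁ = tautology 2 (A ⊓ B ⊃ A)

  ∧-proj₂ : ∀ {α β} → ⊢ α ∧ᶠ β ⇒ β
  ∧-proj₂ = tautology 2 (A ⊓ B ⊃ B)

  ∧-intro : ∀ {α β} → ⊢ α → ⊢ β → ⊢ α ∧ᶠ β
  ∧-intro h k = tautology 2 (A ⊃ B ⊃ A ⊓ B) · h · k

  ⇒-∧ : ∀ {α β γ} → ⊢ α ⇒ β → ⊢ α ⇒ γ → ⊢ α ⇒ β ∧ᶠ γ
  ⇒-∧ h k = tautology 3 ((A ⊃ B) ⊃ (A ⊃ C) ⊃ A ⊃ B ⊓ C) · h · k

  ⇒-ap₂ : ∀ {ω α β γ} → ⊢ α ⇒ β ⇒ γ → ⊢ ω ⇒ α → ⊢ ω ⇒ β → ⊢ ω ⇒ γ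
  ⇒-ap₂ h k l = tautology 4 ((A ⊃ B ⊃ C) ⊃ (D ⊃ A) ⊃ (D ⊃ B) ⊃ D ⊃ C) · h · k · l

  contraposition : ∀ {α β} → ⊢ α ⇒ β → ⊢ ¬ᶠ β ⇒ ¬ᶠ α
  contraposition h = tautology 2 ((A ⊃ B) ⊃ ~ B ⊃ ~ A) · h

  ⇔-to : ∀ {α β} → ⊢ α ⇔ β → ⊢ α ⇒ β
  ⇔-to h = ∧-proj₁ · h

  ⇔-from : ∀ {α β} → ⊢ α ⇔ β → ⊢ β ⇒ α
  ⇔-from h = ∧-proj₂ · h

  ⇔-refl : ∀ {α} → ⊢ α ⇔ α
  ⇔-refl = ∧-intro ⇒-refl ⇒-refl

  ⇔-sym : ∀ {α β} → ⊢ α ⇔ β → ⊢ β ⇔ α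
  ⇔-sym h = ∧-intro (⇔-from h) (⇔-to h)

  ⇔-trans : ∀ {α β γ} → ⊢ α ⇔ β → ⊢ β ⇔ γ → ⊢ α ⇔ γ
  ⇔-trans h k = ∧-intro (⇒-trans (⇔-to h) (⇔-to k)) (⇒-trans (⇔-from k) (⇔-from h))

  ¬-⇔ : ∀ {α α′} → ⊢ α ⇔ α′ → ⊢ ¬ᶠ α ⇔ ¬ᶠ α′
  ¬-⇔ h = tautology 2 ((A ⊃⊂ B) ⊃ (~ A ⊃⊂ ~ B)) · h

  ∨-⇔ : ∀ {α α′ β β′} → ⊢ α ⇔ α′ → ⊢ β ⇔ β′ → ⊢ α ∨ᶠ β ⇔ α′ ∨ᶠ β′
  ∨-⇔ h k = tautology 4 ((A ⊃⊂ B) ⊃ (C ⊃⊂ D) ⊃ (A ⊔ˢ C ⊃⊂ B ⊔ˢ D)) · h · k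

  ∧-⇔ : ∀ {α α′ β β′} → ⊢ α ⇔ α′ → ⊢ β ⇔ β′ → ⊢ α ∧ᶠ β ⇔ α′ ∧ᶠ β′
  ∧-⇔ h k = tautology 4 ((A ⊃⊂ B) ⊃ (C ⊃⊂ D) ⊃ (A ⊓ C ⊃⊂ B ⊓ D)) · h · k

  ⇒-⇔ : ∀ {α α′ β β′} → ⊢ α ⇔ α′ → ⊢ β ⇔ β′ → ⊢ (α ⇒ β) ⇔ (α′ ⇒ β′)
  ⇒-⇔ h k = tautology 4 ((A ⊃⊂ B) ⊃ (C ⊃⊂ D) ⊃ ((A ⊃ C) ⊃⊂ (B ⊃ D))) · h · k

  ⋀-elim : ∀ {α αs} → α ∈ αs → ⊢ ⋀ αs ⇒ α
  ⋀-elim {αs = α ∷ []}     (here refl) = ⇒-refl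
  ⋀-elim {αs = α ∷ _ ∷ _}  (here refl) = ∧-proj₁
  ⋀-elim {αs = _ ∷ _ ∷ _}  (there α∈)  = ⇒-trans ∧-proj₂ (⋀-elim α∈)

  ⋀-intro : ∀ {αs} → All ⊢_ αs → ⊢ ⋀ αs
  ⋀-intro []             = axiom (taut λ _ → refl)
  ⋀-intro (h ∷ [])       = h
  ⋀-intro (h ∷ hs@(_ ∷ _)) = ∧-intro h (⋀-intro hs)

  ⋁-intro : ∀ {α αs} → α ∈ αs → ⊢ α ⇒ ⋁ αs
  ⋁-intro {αs = α ∷ []}     (here refl) = ⇒-refl
  ⋁-intro {αs = α ∷ _ ∷ _}  (here refl) = tautology 2 (A ⊃ A ⊔ˢ B)
  ⋁-intro {αs = _ ∷ _ ∷ _}  (there α∈)  = ⇒-trans (⋁-intro α∈) (tautology 2 (B ⊃ A ⊔ˢ B))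

  -- Modal and hybrid reasoning

  -- Turns axioms about the propositional variables and nominals numbered 0 and 1 into schemes over
  -- arbitrary formulas and terms. The axioms treated this way contain no binder, so safety is
  -- trivial.
  instantiate : Term → Term → Form → Form → Subst
  onProp (instantiate s t α β) zero    = α
  onProp (instantiate s t α β) (suc _) = β
  onTerm (instantiate s t α β) (nom zero)    = s
  onTerm (instantiate s t α β) (nom (suc _)) = t
  onTerm (instantiate s t α β) (svar x)      = svar x

  □-K : ∀ {α β} → ⊢ □ (α ⇒ β) ⇒ □ α ⇒ □ β
  □-K {α} {β} = SB (instantiate (nom 0) (nom 0) α β) _ (axiom (K 0 1))

  ◇-dual : ∀ {α} → ⊢ ◇ α ⇔ ¬ᶠ □ ¬ᶠ α
  ◇-dual {α} = SB (instantiate (nom 0) (nom 0) α α) _ (axiom (dual 0))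

  at-K : ∀ {s α β} → ⊢ at[ s ] (α ⇒ β) ⇒ at[ s ] α ⇒ at[ s ] β
  at-K {s} {α} {β} = SB (instantiate s s α β) _ (axiom (K-at 0 0 1))

  at-selfdual : ∀ {s α} → ⊢ ¬ᶠ at[ s ] α ⇔ at[ s ] ¬ᶠ α
  at-selfdual {s} {α} = SB (instantiate s s α α) _ (axiom (selfdual 0 0))

  at-ref : ∀ {s} → ⊢ at[ s ] tm s
  at-ref {s} = SB (instantiate s s ⊤ᶠ ⊤ᶠ) _ (axiom (ref 0))

  at-intro : ∀ {s α} → ⊢ tm s ∧ᶠ α ⇒ at[ s ] α
  at-intro {s} {α} = SB (instantiate s s α α) _ (axiom (intro 0 0))

  at-back : ∀ {s α} → ⊢ ◇ at[ s ] α ⇒ at[ s ] α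
  at-back {s} {α} = SB (instantiate s s α α) _ (axiom (back 0 0))

  at-agree : ∀ {s t α} → ⊢ at[ s ] at[ t ] α ⇒ at[ t ] α
  at-agree {s} {t} {α} = SB (instantiate s t α α) _ (axiom (agree 0 1 0))

  □-mono : ∀ {α β} → ⊢ α ⇒ β → ⊢ □ α ⇒ □ β
  □-mono h = □-K · nec-□ h

  □-mono₂ : ∀ {α β γ} → ⊢ α ⇒ β ⇒ γ → ⊢ □ α ⇒ □ β ⇒ □ γ
  □-mono₂ h = ⇒-trans (□-mono h) □-K

  □-⇔ : ∀ {α β} → ⊢ α ⇔ β → ⊢ □ α ⇔ □ β
  □-⇔ h = ∧-intro (□-mono (⇔-to h)) (□-mono (⇔-from h))

  ◇-⇔ : ∀ {α β} → ⊢ α ⇔ β → ⊢ ◇ α ⇔ ◇ β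
  ◇-⇔ h = ⇔-trans ◇-dual (⇔-trans (¬-⇔ (□-⇔ (¬-⇔ h))) (⇔-sym ◇-dual))

  ◇-K : ∀ {α β} → ⊢ □ (α ⇒ β) ⇒ ◇ α ⇒ ◇ β
  ◇-K = tautology 5 ((A ⊃⊂ ~ B) ⊃ (C ⊃⊂ ~ D) ⊃ (E ⊃ D ⊃ B) ⊃ E ⊃ A ⊃ C)
    · ◇-dual · ◇-dual · □-mono₂ (tautology 2 ((A ⊃ B) ⊃ ~ B ⊃ ~ A))

  □-∧ : ∀ {α β} → ⊢ □ (α ∧ᶠ β) ⇔ □ α ∧ᶠ □ β
  □-∧ = ∧-intro (⇒-∧ (□-mono ∧-proj₁) (□-mono ∧-proj₂))
                (tautology 3 ((A ⊃ B ⊃ C) ⊃ A ⊓ B ⊃ C) · □-mono₂ (tautology 2 (A ⊃ B ⊃ A ⊓ B)))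

  ◇-∨ : ∀ {α β} → ⊢ ◇ (α ∨ᶠ β) ⇔ ◇ α ∨ᶠ ◇ β
  ◇-∨ = ⇔-trans ◇-dual
       (⇔-trans (¬-⇔ (⇔-trans (□-⇔ (tautology 2 (~ (A ⊔ˢ B) ⊃⊂ ~ A ⊓ ~ B))) □-∧))
       (⇔-trans (tautology 2 (~ (A ⊓ B) ⊃⊂ ~ A ⊔ˢ ~ B))
                (⇔-sym (∨-⇔ ◇-dual ◇-dual))))

  -- A fresh nominal stands for an arbitrary term: substituting `s` for it leaves `α` unchanged.
  -- This extends the rule `nec-at`, given for nominals, to state variables.
  at-generalize : ∀ {α} s i → ¬ (term (nom i) occursIn α) → ⊢ at[ nom i ] α → ⊢ at[ s ] α
  at-generalize {α} s i i∉α h =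
    transport₂ (λ t β → ⊢ at[ t ] β) (/ⁿ-hit s i) (fixes⇒^-id α fixes)
      (SB [ s /ⁿ i ] (fixes⇒safe α fixes) h)
    where fixes = /ⁿ-fixes s i α i∉α

  at-nec : ∀ {α} s → ⊢ α → ⊢ at[ s ] α
  at-nec {α} s h = at-generalize s (fresh α) (nom-fresh α) (nec-at (fresh α) h)

  at-mono : ∀ {s α β} → ⊢ α ⇒ β → ⊢ at[ s ] α ⇒ at[ s ] β
  at-mono h = at-K · at-nec _ h

  at-mono₂ : ∀ {s α β γ} → ⊢ α ⇒ β ⇒ γ → ⊢ at[ s ] α ⇒ at[ s ] β ⇒ at[ s ] γ
  at-mono₂ h = ⇒-trans (at-mono h) at-K

  at-mono₃ : ∀ {s α β γ δ} → ⊢ α ⇒ β ⇒ γ ⇒ δ →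
             ⊢ at[ s ] α ⇒ at[ s ] β ⇒ at[ s ] γ ⇒ at[ s ] δ
  at-mono₃ h = tautology 4 ((A ⊃ B ⊃ C) ⊃ (C ⊃ D) ⊃ A ⊃ B ⊃ D) · at-mono₂ h · at-K

  at-⇔ : ∀ {s α β} → ⊢ α ⇔ β → ⊢ at[ s ] α ⇔ at[ s ] β
  at-⇔ h = ∧-intro (at-mono (⇔-to h)) (at-mono (⇔-from h))

  at-∧ : ∀ {s α β} → ⊢ at[ s ] (α ∧ᶠ β) ⇔ at[ s ] α ∧ᶠ at[ s ] β
  at-∧ = ∧-intro (⇒-∧ (at-mono ∧-proj₁) (at-mono ∧-proj₂))
                 (tautology 3 ((A ⊃ B ⊃ C) ⊃ A ⊓ B ⊃ C) · at-mono₂ (tautology 2 (A ⊃ B ⊃ A ⊓ B)))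

  at-∨ : ∀ {s α β} → ⊢ at[ s ] (α ∨ᶠ β) ⇔ at[ s ] α ∨ᶠ at[ s ] β
  at-∨ = ⇔-trans (at-⇔ (tautology 2 (A ⊔ˢ B ⊃⊂ ~ (~ A ⊓ ~ B))))
        (⇔-trans (⇔-sym at-selfdual)
        (⇔-trans (¬-⇔ (⇔-trans at-∧ (⇔-sym (∧-⇔ at-selfdual at-selfdual))))
                 (tautology 2 (~ (~ A ⊓ ~ B) ⊃⊂ A ⊔ˢ B))))

  -- Agree for the negated formula, contraposed, with Selfdual carrying the negation across both
  -- satisfaction operators.
  at-agree-converse : ∀ {s t α} → ⊢ at[ t ] α ⇒ at[ s ] at[ t ] α
  at-agree-converse = tautology 2 ((~ A ⊃ ~ B) ⊃ B ⊃ A) ·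
    ⇒-trans (⇔-to at-selfdual)
   (⇒-trans (at-mono (⇔-to at-selfdual))
   (⇒-trans at-agree (⇔-from at-selfdual)))

  -- Inside `at[ s ]` both `s` and `t` hold, so Intro for `t` yields `at[ t ] tm s`; Agree then
  -- removes the outer operator.
  at-sym : ∀ {s t} → ⊢ at[ s ] tm t ⇒ at[ t ] tm s
  at-sym = ⇒-trans
    (at-mono₂ (tautology 3 ((A ⊓ B ⊃ C) ⊃ B ⊃ A ⊃ C) · at-intro) · at-ref)
    at-agree

  at-transport : ∀ {s t α} → ⊢ at[ s ] tm t ⇒ at[ s ] α ⇒ at[ t ] α
  at-transport = tautology 4 ((A ⊃ B ⊃ C) ⊃ (C ⊃ D) ⊃ A ⊃ B ⊃ D) ·
    at-mono₂ (tautology 3 ((A ⊓ B ⊃ C) ⊃ A ⊃ B ⊃ C) · at-intro) · at-agree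

  -- Asking for the premise at every nominal spares callers the choice of a fresh one, which is made
  -- here.
  name : ∀ {α} → (∀ i → ⊢ at[ nom i ] α) → ⊢ α
  name {α} h = axiom (name↓ (svar-fresh α)) ·
    nec-↓ (fresh α) (at-generalize (svar (fresh α)) (fresh α) (nom-fresh α) (h (fresh α)))

  -- DA for an arbitrary term: take the axiom at a nominal `i` fresh for the binder formula and
  -- substitute `s` for `i`. Then `α` with `i` for `x` becomes `α` with `s` for `x`.
  at-↓ : ∀ {s x α} → Safe [ s /ˢ x ] α → ⊢ at[ s ] (↓[ x ] α ⇔ α ^ [ s /ˢ x ])
  at-↓ {s} {x} {α} safe =
    transport₂ (λ t (β , γ) → ⊢ at[ t ] (β ⇔ γ)) (/ⁿ-hit s i)
      (cong₂ _,_ (fixes⇒^-id (↓[ x ] α) fixes) (^-compose α (λ _ → refl) i-safe composes))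
      (SB [ s /ⁿ i ] ((↓-safe , α-safe) , (α-safe , ↓-safe)) (axiom (DA i x α)))
    where
    i        = fresh (↓[ x ] α)
    i∉α      = nom-fresh (↓[ x ] α) ∘ inj₂
    fixes    = /ⁿ-fixes s i (↓[ x ] α) (nom-fresh (↓[ x ] α))
    i-safe   = /ˢ-nom-safe i x α
    composes = /ˢ-fresh-nom-composes s i x α i∉α
    ↓-safe   = fixes⇒safe (↓[ x ] α) fixes
    α-safe   = safe-compose α (λ _ → refl) i-safe safe composes

  at-↓-nom : ∀ {i} x α → ⊢ at[ nom i ] (↓[ x ] α ⇔ α ^ [ nom i /ˢ x ])
  at-↓-nom {i} x α = axiom (DA i x α)

  -- The pattern for all equivalences between binder formulas: DA unfolds each one at an arbitrary
  -- nominal `i`, the instances are compared inside `at[ nom i ]`, and `name` discards the operator.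
  ↓-⇔ : ∀ {x α β} → ⊢ α ⇔ β → ⊢ ↓[ x ] α ⇔ ↓[ x ] β
  ↓-⇔ {x} {α} {β} h = name λ i →
    at-mono₃ (tautology 4 ((A ⊃⊂ B) ⊃ (C ⊃⊂ D) ⊃ (B ⊃⊂ D) ⊃ (A ⊃⊂ C)))
      · at-↓-nom x α · at-↓-nom x β
      · nec-at i (SB [ nom i /ˢ x ] (/ˢ-nom-safe i x (α ⇔ β)) h)

  ↓-∨ : ∀ {x α β} → ⊢ ↓[ x ] (α ∨ᶠ β) ⇔ ↓[ x ] α ∨ᶠ ↓[ x ] β
  ↓-∨ {x} {α} {β} = name λ i →
    at-mono₃ (tautology 5 ((A ⊃⊂ B ⊔ˢ C) ⊃ (D ⊃⊂ B) ⊃ (E ⊃⊂ C) ⊃ (A ⊃⊂ D ⊔ˢ E)))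
      · at-↓-nom x (α ∨ᶠ β) · at-↓-nom x α · at-↓-nom x β

  ↓-∧ : ∀ {x α β} → ⊢ ↓[ x ] (α ∧ᶠ β) ⇔ ↓[ x ] α ∧ᶠ ↓[ x ] β
  ↓-∧ {x} {α} {β} = name λ i →
    at-mono₃ (tautology 5 ((A ⊃⊂ B ⊓ C) ⊃ (D ⊃⊂ B) ⊃ (E ⊃⊂ C) ⊃ (A ⊃⊂ D ⊓ E)))
      · at-↓-nom x (α ∧ᶠ β) · at-↓-nom x α · at-↓-nom x β

  ↓-rename : ∀ {x y α} → ¬ (term (svar y) occursIn α) →
             ⊢ ↓[ x ] α ⇔ ↓[ y ] (α ^ [ svar y /ˢ x ])
  ↓-rename {x} {y} {α} y∉α = name λ i →
    at-mono₂ (tautology 3 ((A ⊃⊂ B) ⊃ (C ⊃⊂ B) ⊃ (A ⊃⊂ C)))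
      · at-↓-nom x α
      · transport (λ γ → ⊢ at[ nom i ] (↓[ y ] (α ^ [ svar y /ˢ x ]) ⇔ γ))
          (^-compose α (λ _ → refl) (/ˢ-fresh-svar-safe y x α y∉α)
            (/ˢ-fresh-svar-composes (nom i) y x α y∉α))
          (at-↓-nom y (α ^ [ svar y /ˢ x ]))

  ≈α⇒⇔ : ∀ {α β} → α ≈α β → ⊢ α ⇔ β
  ≈α⇒⇔ ≈refl        = ⇔-refl
  ≈α⇒⇔ (≈sym e)     = ⇔-sym (≈α⇒⇔ e)
  ≈α⇒⇔ (≈trans e f) = ⇔-trans (≈α⇒⇔ e) (≈α⇒⇔ f)
  ≈α⇒⇔ (rename y∉α) = ↓-rename y∉α
  ≈α⇒⇔ (¬-cong e)   = ¬-⇔ (≈α⇒⇔ e)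
  ≈α⇒⇔ (∨-cong e f) = ∨-⇔ (≈α⇒⇔ e) (≈α⇒⇔ f)
  ≈α⇒⇔ (∧-cong e f) = ∧-⇔ (≈α⇒⇔ e) (≈α⇒⇔ f)
  ≈α⇒⇔ (⇒-cong e f) = ⇒-⇔ (≈α⇒⇔ e) (≈α⇒⇔ f)
  ≈α⇒⇔ (◇-cong e)   = ◇-⇔ (≈α⇒⇔ e)
  ≈α⇒⇔ (□-cong e)   = □-⇔ (≈α⇒⇔ e)
  ≈α⇒⇔ (at-cong e)  = at-⇔ (≈α⇒⇔ e)
  ≈α⇒⇔ (↓-cong e)   = ↓-⇔ (≈α⇒⇔ e)

  -- Preprocessing

  -- An equivalence, rather than an implication directed by the sign, so that the congruence rules
  -- carry it to any position in the formula.
  distribute-⇔ : ∀ {s α β} → Distribute s α β → ⊢ α ⇔ β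
  distribute-⇔ +◇∨       = ◇-∨
  distribute-⇔ +↓∨       = ↓-∨
  distribute-⇔ +at∨      = at-∨
  distribute-⇔ -¬∨       = tautology 2 (~ (A ⊔ˢ B) ⊃⊂ ~ A ⊓ ~ B)
  distribute-⇔ +∧∨ʳ      = tautology 3 (A ⊓ (B ⊔ˢ C) ⊃⊂ (A ⊓ B) ⊔ˢ (A ⊓ C))
  distribute-⇔ +∧∨ˡ      = tautology 3 ((A ⊔ˢ B) ⊓ C ⊃⊂ (A ⊓ C) ⊔ˢ (B ⊓ C))
  distribute-⇔ -⇒∨       = tautology 3 ((A ⊔ˢ B ⊃ C) ⊃⊂ (A ⊃ C) ⊓ (B ⊃ C))
  distribute-⇔ -□∧       = □-∧
  distribute-⇔ -↓∧       = ↓-∧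
  distribute-⇔ -at∧      = at-∧
  distribute-⇔ +¬∧       = tautology 2 (~ (A ⊓ B) ⊃⊂ ~ A ⊔ˢ ~ B)
  distribute-⇔ -∨∧ʳ      = tautology 3 (A ⊔ˢ (B ⊓ C) ⊃⊂ (A ⊔ˢ B) ⊓ (A ⊔ˢ C))
  distribute-⇔ -∨∧ˡ      = tautology 3 ((A ⊓ B) ⊔ˢ C ⊃⊂ (A ⊔ˢ C) ⊓ (B ⊔ˢ C))
  distribute-⇔ -⇒∧       = tautology 3 ((A ⊃ B ⊓ C) ⊃⊂ (A ⊃ B) ⊓ (A ⊃ C))
  distribute-⇔ (in-¬ d)  = ¬-⇔ (distribute-⇔ d)
  distribute-⇔ (in-∨ˡ d) = ∨-⇔ (distribute-⇔ d) ⇔-refl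
  distribute-⇔ (in-∨ʳ d) = ∨-⇔ ⇔-refl (distribute-⇔ d)
  distribute-⇔ (in-∧ˡ d) = ∧-⇔ (distribute-⇔ d) ⇔-refl
  distribute-⇔ (in-∧ʳ d) = ∧-⇔ ⇔-refl (distribute-⇔ d)
  distribute-⇔ (in-⇒ˡ d) = ⇒-⇔ (distribute-⇔ d) ⇔-refl
  distribute-⇔ (in-⇒ʳ d) = ⇒-⇔ ⇔-refl (distribute-⇔ d)
  distribute-⇔ (in-◇ d)  = ◇-⇔ (distribute-⇔ d)
  distribute-⇔ (in-□ d)  = □-⇔ (distribute-⇔ d)
  distribute-⇔ (in-at d) = at-⇔ (distribute-⇔ d)
  distribute-⇔ (in-↓ d)  = ↓-⇔ (distribute-⇔ d)

  Valid : Ineq → Set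
  Valid (α ≼ β) = ⊢ α ⇒ β

  SvarFree : Form → Set
  SvarFree θ = ∀ z → ¬ (term (svar z) freeIn θ)

  /ᵖ-safe : ∀ {θ p} → SvarFree θ → ∀ α → Safe [ θ /ᵖ p ] α
  /ᵖ-safe {θ} {p} closed α = nonCapturing⇒safe α λ a z _ _ → go a z
    where
    go : ∀ a z → term (svar z) freeIn image [ θ /ᵖ p ] a → a ≡ term (svar z)
    go (prop q) z g with q ≟ p
    ... | yes _ = contradiction g (closed z)
    go (term t) z g = sym g

  -- Distribution and splitting are equivalences and Boolean reasoning; variable elimination is the
  -- substitution rule applied to the whole implication.
  pre-sound : ∀ {e S} → PreRule e S → Valid e → All Valid S
  pre-sound (distˡ d) h = ⇒-trans (⇔-from (distribute-⇔ d)) h ∷ []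
  pre-sound (distʳ d) h = ⇒-trans h (⇔-to (distribute-⇔ d)) ∷ []
  pre-sound split∨    h = (tautology 3 ((A ⊔ˢ B ⊃ C) ⊃ A ⊃ C) · h) ∷
                          (tautology 3 ((A ⊔ˢ B ⊃ C) ⊃ B ⊃ C) · h) ∷ []
  pre-sound split∧    h = ⇒-trans h ∧-proj₁ ∷ ⇒-trans h ∧-proj₂ ∷ []
  pre-sound (elim⊥ {α} {β} p _ _ _) h = SB [ ⊥ᶠ /ᵖ p ] (/ᵖ-safe (λ _ ()) (α ⇒ β)) h ∷ []
  pre-sound (elim⊤ {α} {β} p _ _ _) h = SB [ ⊤ᶠ /ᵖ p ] (/ᵖ-safe (λ _ ()) (β ⇒ α)) h ∷ []

  preprocess-sound : ∀ {S T} → Star (Replace PreRule) S T → All Valid S → All Valid T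
  preprocess-sound ε                          hs = hs
  preprocess-sound (replace S∼ _ rule ◅ steps) hs = preprocess-sound steps
    (All.++⁺ (pre-sound rule (All.lookup hs (Equivalence.from S∼ (here refl))))
             (All.tabulate λ e∈Γ → All.lookup hs (Equivalence.from S∼ (there e∈Γ))))

  -- Reduction

  at-¬-swap : ∀ {s t} → ⊢ at[ s ] ¬ᶠ tm t ⇒ ¬ᶠ at[ t ] tm s
  at-¬-swap = ⇒-trans (⇔-from at-selfdual) (contraposition at-sym)

  ¬-at-swap : ∀ {s t} → ⊢ ¬ᶠ at[ t ] tm s ⇒ at[ s ] ¬ᶠ tm t
  ¬-at-swap = ⇒-trans (contraposition at-sym) (⇔-to at-selfdual)

  -- All translations are demanded, because `tm s ≼ ¬ᶠ tm t` has two.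
  Proves : Form → System → Set
  Proves ω S = ∀ {e χ} → e ∈ S → Tr e χ → ⊢ ω ⇒ χ

  -- One translation suffices: when both forms apply, they are interderivable by symmetry of
  -- `at[ s ] tm t` and Selfdual.
  tr-lower : ∀ {ω s γ χ} → ⊢ ω ⇒ at[ s ] γ → Tr (tm s ≼ γ) χ → ⊢ ω ⇒ χ
  tr-lower h lower = h
  tr-lower h upper = ⇒-trans h at-¬-swap

  tr-upper : ∀ {ω s γ χ} → ⊢ ω ⇒ ¬ᶠ at[ s ] γ → Tr (γ ≼ ¬ᶠ tm s) χ → ⊢ ω ⇒ χ
  tr-upper h upper = h
  tr-upper h lower = ⇒-trans h ¬-at-swap

  tr-unique : ∀ {ω e χ χ′} → Tr e χ → ⊢ ω ⇒ χ → Tr e χ′ → ⊢ ω ⇒ χ′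
  tr-unique lower h = tr-lower h
  tr-unique upper h = tr-upper h

  -- By Intro, `α` implies `tm s ⇒ at[ s ] α`. Under the box this turns `◇ tm s` into `◇ at[ s ] α`,
  -- and Back removes the diamond.
  □-instance : ∀ {s α} → ⊢ □ α ⇒ ◇ tm s ⇒ at[ s ] α
  □-instance = tautology 4 ((A ⊃ B ⊃ C) ⊃ (C ⊃ D) ⊃ A ⊃ B ⊃ D)
    · ⇒-trans (□-mono (tautology 3 ((A ⊓ B ⊃ C) ⊃ B ⊃ A ⊃ C) · at-intro)) ◇-K
    · at-back

  -- `□-instance` for the negation of `α`, contraposed.
  ◇-bridge : ∀ {s α} → ⊢ at[ s ] α ⇒ ◇ tm s ⇒ ◇ α
  ◇-bridge = tautology 5 ((A ⊃ B ⊃ C) ⊃ (~ D ⊃⊂ C) ⊃ (E ⊃⊂ ~ A) ⊃ D ⊃ B ⊃ E)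
    · □-instance · at-selfdual · ◇-dual

  -- The approximation rule for the diamond read backwards: a named successor satisfying `α`
  -- witnesses `◇ α`.
  at-◇ : ∀ {s t α} → ⊢ at[ t ] α ⇒ at[ s ] ◇ tm t ⇒ at[ s ] ◇ α
  at-◇ = ⇒-trans at-agree-converse (at-mono₂ ◇-bridge)

  -- The dual for the box: the premise with `□ ¬ᶠ tm t` says that `t` names a successor of `s`, and
  -- `□-instance` would give `α` there.
  ¬-at-□ : ∀ {s t α} → ⊢ ¬ᶠ at[ t ] α ⇒ ¬ᶠ at[ s ] □ ¬ᶠ tm t ⇒ ¬ᶠ at[ s ] □ α
  ¬-at-□ = tautology 4 ((A ⊃ B ⊃ C) ⊃ (~ D ⊃⊂ B) ⊃ ~ C ⊃ ~ D ⊃ ~ A)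
    · (tautology 4 ((A ⊃ B ⊃ C) ⊃ (C ⊃ D) ⊃ A ⊃ B ⊃ D) · at-mono₂ □-instance · at-agree)
    · ⇔-trans at-selfdual (at-⇔ (⇔-sym ◇-dual))

  -- Suppose `α ⇒ β` at `s`. If `s` is named `j`, then `α` and so `β` hold there; were it also named
  -- `k`, Intro would give `at[ k ] β`. The facts about `j` and `k` are carried inside `at[ s ]` by
  -- the converse of Agree.
  ¬-at-⇒ : ∀ {s j k α β} → ⊢ at[ j ] α ⇒ ¬ᶠ at[ k ] β ⇒
           ¬ᶠ at[ s ] (tm j ⇒ ¬ᶠ tm k) ⇒ ¬ᶠ at[ s ] (α ⇒ β)
  ¬-at-⇒ = tautology 5 ((A ⊃ B ⊃ C ⊃ D) ⊃ (E ⊃ B) ⊃ A ⊃ E ⊃ ~ D ⊃ ~ C)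
    · (tautology 5 ((A ⊃ B) ⊃ (B ⊃ C ⊃ D ⊃ E) ⊃ A ⊃ C ⊃ D ⊃ E) · at-agree-converse · at-mono₃ under)
    · ⇒-trans (⇔-to at-selfdual) (⇒-trans at-agree-converse (at-mono (⇔-from at-selfdual)))
    where
    elim : ∀ {s α} → ⊢ at[ s ] α ⇒ tm s ⇒ α
    -- Intro for the negation of `α`, contraposed by Selfdual.
    elim = tautology 4 ((A ⊓ ~ B ⊃ C) ⊃ (~ D ⊃⊂ C) ⊃ D ⊃ A ⊃ B) · at-intro · at-selfdual

    under : ∀ {j k α β} → ⊢ at[ j ] α ⇒ ¬ᶠ at[ k ] β ⇒ (α ⇒ β) ⇒ tm j ⇒ ¬ᶠ tm k
    under = tautology 6 ((A ⊃ B ⊃ C) ⊃ (D ⊓ E ⊃ atom 5F) ⊃ A ⊃ ~ atom 5F ⊃ (C ⊃ E) ⊃ B ⊃ ~ D)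
      · elim · at-intro

  at-↓-↝ : ∀ {s x α β} → α [ [ s /ˢ x ] ]↝ β → ⊢ at[ s ] ↓[ x ] α ⇔ at[ s ] β
  at-↓-↝ (α′ , α≈α′ , safe , refl) = ⇔-trans (at-⇔ (↓-⇔ (≈α⇒⇔ α≈α′)))
    (∧-intro (at-K · (at-mono ∧-proj₁ · at-↓ safe)) (at-K · (at-mono ∧-proj₂ · at-↓ safe)))

  reduce-sound : ∀ {S e new ω χ} → ReduceRule S e new → Proves ω new → Tr e χ → ⊢ ω ⇒ χ
  reduce-sound split∧ h =
    tr-lower (⇒-trans (⇒-∧ (h (here refl) lower) (h (there (here refl)) lower)) (⇔-from at-∧))
  reduce-sound split∨ h =
    tr-upper (⇒-trans (⇒-∧ (h (here refl) upper) (h (there (here refl)) upper))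
                      (⇒-trans (tautology 2 (~ A ⊓ ~ B ⊃ ~ (A ⊔ˢ B))) (contraposition (⇔-to at-∨))))
  reduce-sound (approx◇ _) h =
    tr-lower (⇒-ap₂ at-◇ (h (here refl) lower) (h (there (here refl)) lower))
  reduce-sound (approx□ _) h =
    tr-upper (⇒-ap₂ ¬-at-□ (h (here refl) upper) (h (there (here refl)) upper))
  reduce-sound approx-atˡ h = tr-lower (⇒-trans (h (here refl) lower) at-agree-converse)
  reduce-sound approx-atʳ h = tr-upper (⇒-trans (h (here refl) upper) (contraposition at-agree))
  reduce-sound (approx↓ˡ r) h = tr-lower (⇒-trans (h (here refl) lower) (⇔-from (at-↓-↝ r)))
  reduce-sound (approx↓ʳ r) h = tr-upper (⇒-trans (h (here refl) upper) (contraposition (⇔-to (at-↓-↝ r))))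
  reduce-sound (approx⇒ _ _ _) h = tr-upper
    (⇒-ap₂ (tautology 4 ((A ⊃ B ⊃ C ⊃ D) ⊃ A ⊓ B ⊃ C ⊃ D) · ¬-at-⇒)
      (⇒-∧ (h (here refl) lower) (h (there (here refl)) upper))
      (h (there (there (here refl))) upper))
  reduce-sound resid¬ˡ h = tr-lower (⇒-trans (h (here refl) upper) (⇔-to at-selfdual))
  reduce-sound resid¬ʳ h = tr-upper
    (⇒-trans (h (here refl) lower) (tautology 2 ((~ A ⊃⊂ B) ⊃ A ⊃ ~ B) · at-selfdual))

  -- Quantifying over a context `ω` replaces the conjunction of translations, which makes the order
  -- and repetition of members and the choice of translations immaterial.
  Entails : System → Form → Set
  Entails S γ = ∀ ω → Proves ω S → ⊢ ω ⇒ γ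

  entails-resp-∼ : ∀ {S L γ} → S ∼[ set ] L → Entails S γ → Entails L γ
  entails-resp-∼ S∼L ent ω h = ent ω (h ∘ Equivalence.to S∼L)

  reduceStep-entails : ∀ {S T γ} → ReduceStep S T → Entails S γ → Entails T γ
  reduceStep-entails {S} {T} (replace {e = e} {Γ} {new} S∼ _ rule) ent ω h = ent ω go
    where
    go : Proves ω S
    go e∈S trχ with Equivalence.to S∼ e∈S
    ... | here refl = reduce-sound rule (h ∘ ∈-++⁺ˡ) trχ
    ... | there e∈Γ = h (∈-++⁺ʳ new e∈Γ) trχ

  reduce-entails : ∀ {S T γ} → Star ReduceStep S T → Entails S γ → Entails T γ
  reduce-entails ε            ent = ent
  reduce-entails (s ◅ steps) ent = reduce-entails steps (reduceStep-entails s ent)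

  -- Substitution instances and the Ackermann rules

  -- Here `χ₀` is a translation of `e` up to renaming of bound variables, chosen so that `σ` is safe
  -- for it; the context only has to prove its instance.
  SubstProves : Subst → Form → Ineq → Set
  SubstProves σ ω e = ∃[ χ₀ ] ((∀ {χ} → Tr e χ → ⊢ χ₀ ⇒ χ) × Safe σ χ₀ × ⊢ ω ⇒ χ₀ ^ σ)

  -- The conjunction of the chosen `χ₀` is a context that proves the whole system, hence `γ`. The
  -- substitution rule applied to that implication, and the proofs of the instances from `ω`, give
  -- the claim.
  entails-^ : ∀ {S γ σ ω} → Entails S γ → Safe σ γ →
              All (SubstProves σ ω) S → ⊢ ω ⇒ γ ^ σ
  entails-^ {σ = σ} {ω} ent safe hs =
    let ω₀ , proves , ω₀-safe , h = conj hs
    in ⇒-trans h (SB σ (ω₀-safe , safe) (ent ω₀ proves))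
    where
    conj : ∀ {L} → All (SubstProves σ ω) L → ∃[ ω₀ ] (Proves ω₀ L × Safe σ ω₀ × ⊢ ω ⇒ ω₀ ^ σ)
    conj [] = ⊤ᶠ , (λ ()) , tt , const-⇒ (⋀-intro [])
    conj ((χ₀ , proves , χ₀-safe , h) ∷ hs) =
      let ω₀ , proves′ , ω₀-safe , h′ = conj hs
      in χ₀ ∧ᶠ ω₀ ,
         (λ { (here refl) t → ⇒-trans ∧-proj₁ (proves t)
            ; (there e∈)  t → ⇒-trans ∧-proj₂ (proves′ e∈ t) }) ,
         (χ₀-safe , ω₀-safe) , ⇒-∧ h h′

  onProp-/ᵖ : ∀ θ p → onProp [ θ /ᵖ p ] p ≡ θ
  onProp-/ᵖ θ p with p ≟ p
  ... | yes _  = refl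
  ... | no p≢p = contradiction refl p≢p

  lowers-substProves : ∀ {θ p γs γs′ ω} → SubstLowers [ θ /ᵖ p ] γs γs′ →
    Proves ω (lowers γs′) → All (SubstProves [ θ /ᵖ p ] ω) (lowers γs)
  lowers-substProves [] h = []
  lowers-substProves {γs = (t , _) ∷ _} ((refl , γ″ , γ≈γ″ , safe , refl) ∷ rs) h =
    (at[ t ] γ″ , tr-lower (⇔-from (at-⇔ (≈α⇒⇔ γ≈γ″))) , safe , h (here refl) lower)
    ∷ lowers-substProves rs (h ∘ there)

  uppers-substProves : ∀ {θ p βs βs′ ω} → SubstUppers [ θ /ᵖ p ] βs βs′ →
    Proves ω (uppers βs′) → All (SubstProves [ θ /ᵖ p ] ω) (uppers βs)
  uppers-substProves [] h = []
  uppers-substProves {βs = (_ , u) ∷ _} (((β″ , β≈β″ , safe , refl) , refl) ∷ rs) h =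
    (¬ᶠ at[ u ] β″ , tr-upper (contraposition (⇔-to (at-⇔ (≈α⇒⇔ β≈β″)))) , safe , h (here refl) upper)
    ∷ uppers-substProves rs (h ∘ there)

  ackermannStep-entails : ∀ {S T i j} → AckermannStep S T →
    Entails S (¬ᶠ at[ nom i ] tm (nom j)) → Entails T (¬ᶠ at[ nom i ] tm (nom j))
  ackermannStep-entails (right {p = p} {ss = ss} {γs′ = γs′} S∼ _ _ rγ rβ) ent ω h =
    -- The goal contains only nominals, so the substitution fixes it by computation and safety is
    -- trivial.
    entails-^ (entails-resp-∼ S∼ ent) tt
      (All.++⁺ (All.map⁺ (All.tabulate bound))
        (All.++⁺ (lowers-substProves rγ (h ∘ ∈-++⁺ˡ))
                 (uppers-substProves rβ (h ∘ ∈-++⁺ʳ (lowers γs′)))))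
    where
    θ = ⋁ (map tm ss)
    bound : ∀ {s} → s ∈ ss → SubstProves [ θ /ᵖ p ] ω (tm s ≼ var p)
    bound {s} s∈ = at[ s ] var p , tr-lower ⇒-refl , tt ,
      transport (λ α → ⊢ ω ⇒ at[ s ] α) (sym (onProp-/ᵖ θ p))
        -- The discarded inequality becomes the theorem that `s` satisfies a disjunction having
        -- `tm s` as a disjunct.
        (const-⇒ (at-mono (⋁-intro (∈-map⁺ tm s∈)) · at-ref))
  ackermannStep-entails (left {p = p} {ss = ss} {γs′ = γs′} S∼ _ _ rγ rβ) ent ω h =
    entails-^ (entails-resp-∼ S∼ ent) tt
      (All.++⁺ (All.map⁺ (All.tabulate bound))
        (All.++⁺ (lowers-substProves rγ (h ∘ ∈-++⁺ˡ))
                 (uppers-substProves rβ (h ∘ ∈-++⁺ʳ (lowers γs′)))))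
    where
    θ = ⋀ (map (λ s → ¬ᶠ tm s) ss)
    bound : ∀ {s} → s ∈ ss → SubstProves [ θ /ᵖ p ] ω (var p ≼ ¬ᶠ tm s)
    bound {s} s∈ = ¬ᶠ at[ s ] var p , tr-upper ⇒-refl , tt ,
      transport (λ α → ⊢ ω ⇒ ¬ᶠ at[ s ] α) (sym (onProp-/ᵖ θ p))
        -- The conjunction has `¬ᶠ tm s` as a conjunct, so its truth at `s` would contradict Ref.
        (const-⇒ (tautology 3 ((A ⊃ B) ⊃ (~ C ⊃⊂ B) ⊃ C ⊃ ~ A)
          · at-mono (⋀-elim (∈-map⁺ (λ s → ¬ᶠ tm s) s∈)) · at-selfdual · at-ref))

  ackermann-entails : ∀ {S T i j} → Star AckermannStep S T →
    Entails S (¬ᶠ at[ nom i ] tm (nom j)) → Entails T (¬ᶠ at[ nom i ] tm (nom j))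
  ackermann-entails ε           ent = ent
  ackermann-entails (s ◅ steps) ent = ackermann-entails steps (ackermannStep-entails s ent)

  -- If `i` and `j` named the same state, then `α` at `i` would move to `j` and give `β` there,
  -- against the second inequality.
  approximate-entails : ∀ {α β i j} → ⊢ α ⇒ β →
    Entails ((tm (nom i) ≼ α) ∷ (β ≼ ¬ᶠ tm (nom j)) ∷ []) (¬ᶠ at[ nom i ] tm (nom j))
  approximate-entails h ω proves =
    tautology 5 ((A ⊃ B ⊃ C) ⊃ (C ⊃ D) ⊃ (E ⊃ B) ⊃ (E ⊃ ~ D) ⊃ E ⊃ ~ A)
      · at-transport · at-mono h · proves (here refl) lower · proves (there (here refl)) upper

  -- Output

  svarsTo-safe : ∀ ν α → Safe (svarsTo ν) α
  svarsTo-safe ν α = nonCapturing⇒safe α λ { (prop _) _ _ _ () ; (term (nom _)) _ _ _ () ; (term (svar _)) _ _ _ () }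

  tm-^⁻ : ∀ {ν} α {s} → tm s ≡ α ^ svarsTo ν → ∃[ t ] (α ≡ tm t × s ≡ onTerm (svarsTo ν) t)
  tm-^⁻ (tm t) refl = t , refl , refl

  ¬-^⁻ : ∀ {ν} α {β} → ¬ᶠ β ≡ α ^ svarsTo ν → ∃[ α′ ] (α ≡ ¬ᶠ α′ × β ≡ α′ ^ svarsTo ν)
  ¬-^⁻ (¬ᶠ α) refl = α , refl , refl

  -- Replacing state variables by nominals keeps the outer shape of formulas, so a translation after
  -- the replacement comes from one before it. The separate index `e′` with its equation permits
  -- matching on `Tr`.
  tr-^⁻ : ∀ {ν} e {e′ χ} → e′ ≡ substIneq (svarsTo ν) e → Tr e′ χ →
          ∃[ χ₀ ] (Tr e χ₀ × χ ≡ χ₀ ^ svarsTo ν)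
  tr-^⁻ (α ≼ β) eq lower with tm-^⁻ α (cong Ineq.lhs eq) | cong Ineq.rhs eq
  ... | t , refl , refl | refl = at[ t ] β , lower , refl
  tr-^⁻ (α ≼ β) eq upper with ¬-^⁻ β (cong Ineq.rhs eq) | cong Ineq.lhs eq
  ... | α′ , refl , e | refl with tm-^⁻ α′ e
  ...   | t , refl , refl = ¬ᶠ at[ t ] α , upper , refl

  pointwise-∈ : ∀ {a b} {X : Set a} {Y : Set b} {R : X → Y → Set} {x xs ys} →
    Pointwise R xs ys → x ∈ xs → ∃[ y ] (y ∈ ys × R x y)
  pointwise-∈ (r ∷ rs) (here refl) = _ , here refl , r
  pointwise-∈ (r ∷ rs) (there x∈)  = let y , y∈ , r′ = pointwise-∈ rs x∈ in y , there y∈ , r′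

  -- The final replacement of state variables is one more use of `entails-^`, with the antecedent of
  -- the translated quasi-inequality as context.
  trQuasi-sound : ∀ {T i j ν χ} → Entails T (¬ᶠ at[ nom i ] tm (nom j)) →
    TrQuasi (substQuasi (svarsTo ν) (& T ⟹ (tm (nom i) ≼ ¬ᶠ tm (nom j)))) χ → ⊢ χ
  trQuasi-sound {T} {ν = ν} ent (tr {χs = χs} T∼ trs) =
    entails-^ {σ = svarsTo ν} ent tt (All.tabulate member)
    where
    member : ∀ {e} → e ∈ T → SubstProves (svarsTo ν) (⋀ χs) e
    member {e} e∈T with pointwise-∈ trs (Equivalence.to T∼ (∈-map⁺ (substIneq (svarsTo ν)) e∈T))
    ... | χ , χ∈ , t with tr-^⁻ e refl t
    ...   | χ₀ , t₀ , refl = χ₀ , tr-unique t₀ ⇒-refl , svarsTo-safe ν χ₀ , ⋀-elim χ∈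

  reduced-sound : ∀ {i j S Ts} → All Valid S →
    Pointwise (λ (α ≼ β) T → Reduce ((tm (nom i) ≼ α) ∷ (β ≼ ¬ᶠ tm (nom j)) ∷ []) T) S Ts →
    All (λ T → Entails T (¬ᶠ at[ nom i ] tm (nom j))) Ts
  reduced-sound []       []                            = []
  reduced-sound (h ∷ hs) ((M , steps , ackermann , _) ∷ rs) =
    ackermann-entails ackermann (reduce-entails steps (approximate-entails h))
    ∷ reduced-sound hs rs

  trSet-sound : ∀ {Qs χ} → (∀ Q → Q ∈ Qs → ∀ χ → TrQuasi Q χ → ⊢ χ) → TrSet Qs χ → ⊢ χ
  trSet-sound h (tr Qs∼L trs) = ⋀-intro (go (h _ ∘ Equivalence.from Qs∼L) trs)
    where
    go : ∀ {L χs} → (∀ {Q} → Q ∈ L → ∀ χ → TrQuasi Q χ → ⊢ χ) → Pointwise TrQuasi L χs → All ⊢_ χs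
    go h []       = []
    go h (t ∷ ts) = h (here refl) _ t ∷ go (h ∘ there) ts

corollary7p7 : (φ ψ : Form) → SkeletalSahlqvist φ ψ →
    (Qs : List Quasi) → PureOutput φ ψ Qs →
    (∀ Q → Q ∈ Qs → ∀ χ → TrQuasi Q χ → ⊢[ φ ⇒ ψ ] χ) ×
    (∀ χ → TrSet Qs χ → ⊢[ φ ⇒ ψ ] χ)
corollary7p7 φ ψ _ Qs out = quasi-sound , λ χ → trSet-sound quasi-sound
  where
  open PureOutput out

  quasi-sound : ∀ Q → Q ∈ Qs → ∀ χ → TrQuasi Q χ → ⊢[ φ ⇒ ψ ] χ
  quasi-sound Q Q∈ χ t with ∈-map⁻ (substQuasi (svarsTo ν)) (transport (Q ∈_) output Q∈)
  ... | _ , q∈ , refl with ∈-map⁻ (λ T → & T ⟹ (tm (nom i₀) ≼ ¬ᶠ tm (nom i₁))) q∈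
  ...   | T , T∈ , refl = trQuasi-sound
    -- The initial inequality `φ ≼ ψ` is valid by the added axiom `extra`.
    (All.lookup (reduced-sound (preprocess-sound (proj₁ isPreprocess) (extra ∷ [])) isReduced) T∈) t
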